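{- Any streaming algorithm for \textsc{Connectivity} in the VA model that works on a family of graphs including all interval graphs and uses $p$ passes over the stream requires $\Omega(n/p)$ bits of memory on $n$-vertex graphs.
   Context: An interval graph is the intersection graph of a finite family of intervals on the real line. \textsc{Connectivity}: decide whether the graph is connected. In the Vertex Arrival (VA) streaming model, vertices arrive one by one in arbitrary fixed order and each edge is revealed when the later of its two endpoints arrives. A $p$-pass algorithm reads the stream $p$ times with unlimited computation; memory is in bits. "Requires $\Omega(f)$ bits" means there is a constant $c>0$ such that every such algorithm uses at least $cf$ bits on some $n$-vertex input of the class, for all sufficiently large $n$ and all $p$. -}

module Defs where

open import Data.Nat using (ℕ; zero; suc)
open import Data.Bool using (Bool; true; false)
open import Data.Fin using (Fin; toℕ; inject≤)
open import Data.Fin.Properties using (toℕ≤n)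
open import Data.List using (List; foldl; allFin)
open import Data.Vec using (Vec)
open import Data.Product using (Σ; _×_; ∃)
open import Data.Rational using (ℚ; _≤_)
open import Relation.Binary.PropositionalEquality using (_≡_; _≢_)
open import Function.Bundles using (_⇔_)

record Graph (n : ℕ) : Set where
  field
    adj   : Fin n → Fin n → Bool
    sym   : ∀ i j → adj i j ≡ adj j i
    irrfl : ∀ i → adj i i ≡ false
open Graph public

record Interval : Set where
  constructor [_,_]⟨_⟩
  field
    lo hi : ℚ
    lo≤hi : lo ≤ hi
open Interval public

Intersect : Interval → Interval → Set
Intersect I J = (lo I ≤ hi J) × (lo J ≤ hi I)

IsIntervalGraph : ∀ {n} → Graph n → Set
IsIntervalGraph {n} G =
  Σ (Fin n → Interval) λ I →
    ∀ i j → i ≢ j → (adj G i j ≡ true) ⇔ Intersect (I i) (I j)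

data Reach {n} (G : Graph n) : Fin n → Fin n → Set where
  here : ∀ {u} → Reach G u u
  step : ∀ {u v w} → adj G u v ≡ true → Reach G v w → Reach G u w

Connected : ∀ {n} → Graph n → Set
Connected {n} G = ∀ (u v : Fin n) → Reach G u v

-- Vertex-arrival stream. Vertices are identified with their arrival
-- position; the i-th item reveals vertex i together with its adjacency
-- to every earlier vertex j < i.
Item : ∀ {n} → Fin n → Set
Item i = Fin (toℕ i) → Bool

Stream : ℕ → Set
Stream n = (i : Fin n) → Item i

stream : ∀ {n} → Graph n → Stream n
stream G i j = adj G i (inject≤ j (toℕ≤n i))

record Alg (n p s : ℕ) : Set where
  field
    init   : Vec Bool s
    update : Fin p → (i : Fin n) → Item i → Vec Bool s → Vec Bool s
    output : Vec Bool s → Bool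
open Alg public

runPass : ∀ {n p s} → Alg n p s → Stream n → Fin p → Vec Bool s → Vec Bool s
runPass {n} A σ k st = foldl (λ m i → update A k i (σ i) m) st (allFin n)

run : ∀ {n p s} → Alg n p s → Stream n → Bool
run {n} {p} A σ = output A (foldl (λ m k → runPass A σ k m) (init A) (allFin p))

-- A solves Connectivity on (a family including) all interval graphs:
-- for every n-vertex interval graph, in every arrival order.
SolvesConnOnIntervals : ∀ {n p s} → Alg n p s → Set
SolvesConnOnIntervals {n} A =
  ∀ (G : Graph n) → IsIntervalGraph G → (run A (stream G) ≡ true) ⇔ Connected G

{-# OPTIONS --safe #-}
module Submission where

-- Without function extensionality an algorithm might tell apart two stream items that are
-- pointwise equal, so the argument only identifies items coming from equal complete rows of
-- the adjacency matrix: it is a lower bound in the stronger adjacency-list model. There a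
-- two-party reduction is impossible for chordal graphs (the Euler characteristic of the
-- clique complex, i.e. the number of components, splits into one summand per party), but
-- three parties with inputs on their foreheads suffice.
--
-- A gadget has bits x, y, z and vertices a, b, b′, c occupying [10g, 10g + 10]:
--   a = [0, 8 if y, else 6 if z, else 3]    b = [0, 8 if x, else 3]
--   b′ = [5 if z, else 9; 10]               c = [7, 10]
-- The row of a does not depend on x, those of b and b′ not on y, that of c not on z, and the
-- chain of gadgets is connected iff no gadget has x = y = z = 0. Hence p passes with s bits
-- decide three-party disjointness by a number-on-forehead protocol with 3ps bits.
--
-- Hard instances consist of m blocks: pointers Xᵢ, Yᵢ ∈ [r] and a table Zᵢ ∈ {0,1}^(r × r), with
-- gadget (i, s, t) broken iff Xᵢ = s, Yᵢ = t and Zᵢ(s, t) = 1. Two applications of Cauchy–Schwarz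
-- to the sign ∏ (−1)^Zᵢ(Xᵢ, Yᵢ) bound the density of a cylinder intersection without broken
-- instances by (2/r)^(m/4), while intact instances have density 2^(−m). For r = 64 this
-- forces m ≤ 12ps, and n is about 4r²m.

open import Defs hiding (sym)
open import Data.Bool using (Bool; true; false; _∧_; _∨_; not; if_then_else_)
import Data.Bool.Properties as Boolₚ
open import Data.Fin using (Fin; zero; suc; toℕ; #_; _≟_; splitAt; _↑ˡ_; _↑ʳ_; fromℕ<; inject≤; combine; remQuot)
import Data.Fin.Properties as Finₚ
open import Data.Integer as ℤ using (ℤ; +_; -[1+_]; 0ℤ; 1ℤ; -1ℤ; +≤+; nonNegative; drop‿+≤+; ∣_∣)
import Data.Integer.Properties as ℤₚ
open import Data.Integer.Tactic.RingSolver using (solve-∀)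
open import Data.List using (List; []; _∷_; _++_; length; map; foldl; concatMap; cartesianProductWith; cartesianProduct; allFin)
  renaming (tabulate to tabulateˡ)
import Data.List.Properties as Listₚ
open import Data.List.Membership.Propositional using (_∈_)
open import Data.List.Membership.Propositional.Properties using (∈-cartesianProductWith⁺)
open import Data.List.Relation.Unary.Any using (here; there)
open import Data.Nat as ℕ using (ℕ; zero; suc; NonZero; _≤ᵇ_; z≤n; s≤s)
import Data.Nat.Coprimality as Coprime
import Data.Nat.DivMod as DivMod
import Data.Nat.Properties as ℕₚ
import Data.Nat.Tactic.RingSolver as ℕRing
open import Data.Product using (Σ; _×_; _,_; proj₁; proj₂; ∃)
import Data.Rational as ℚ
open import Data.Sum using (_⊎_; inj₁; inj₂; [_,_]′)
open import Data.Vec using (Vec; []; _∷_; lookup; tabulate; replicate; _[_]%=_)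
import Data.Vec.Properties as Vecₚ
open import Function using (_∘_; const; id)
open import Function.Bundles using (mk⇔; Equivalence)
open import Relation.Binary.Definitions using (DecidableEquality; tri<; tri≈; tri>)
open import Relation.Binary.PropositionalEquality
open import Relation.Nullary using (does; yes; no; ¬_; contradiction)
open import Relation.Nullary.Decidable using (dec-true; dec-false)

-- Finite integer sums and the Cauchy-Schwarz inequality.

module Counting where

  open import Data.Integer using (_+_; _*_; -_; _-_; _≤_)

  ∑ : {A : Set} → List A → (A → ℤ) → ℤ
  ∑ []       f = 0ℤ
  ∑ (x ∷ xs) f = f x + ∑ xs f

  module _ {A : Set} where

    ∑-cong : ∀ (xs : List A) {f g : A → ℤ} → (∀ x → f x ≡ g x) → ∑ xs f ≡ ∑ xs g
    ∑-cong []       e = refl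
    ∑-cong (x ∷ xs) e = cong₂ _+_ (e x) (∑-cong xs e)

    ∑-mono : ∀ (xs : List A) {f g : A → ℤ} → (∀ x → f x ≤ g x) → ∑ xs f ≤ ∑ xs g
    ∑-mono []       e = ℤₚ.≤-refl
    ∑-mono (x ∷ xs) e = ℤₚ.+-mono-≤ (e x) (∑-mono xs e)

    ∑-0 : ∀ (xs : List A) → ∑ xs (λ _ → 0ℤ) ≡ 0ℤ
    ∑-0 []       = refl
    ∑-0 (x ∷ xs) = trans (ℤₚ.+-identityˡ _) (∑-0 xs)

    ∑-nonneg : ∀ (xs : List A) {f : A → ℤ} → (∀ x → 0ℤ ≤ f x) → 0ℤ ≤ ∑ xs f
    ∑-nonneg xs {f} e = subst (_≤ ∑ xs f) (∑-0 xs) (∑-mono xs e)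

    ∑-+ : ∀ (xs : List A) (f g : A → ℤ) → ∑ xs (λ x → f x + g x) ≡ ∑ xs f + ∑ xs g
    ∑-+ []       f g = refl
    ∑-+ (x ∷ xs) f g rewrite ∑-+ xs f g = interchange (f x) (g x) (∑ xs f) (∑ xs g)
      where
      interchange : ∀ a b c d → (a + b) + (c + d) ≡ (a + c) + (b + d)
      interchange = solve-∀

    ∑-*ˡ : ∀ (xs : List A) c (f : A → ℤ) → ∑ xs (λ x → c * f x) ≡ c * ∑ xs f
    ∑-*ˡ []       c f = sym (ℤₚ.*-zeroʳ c)
    ∑-*ˡ (x ∷ xs) c f rewrite ∑-*ˡ xs c f = sym (ℤₚ.*-distribˡ-+ c (f x) (∑ xs f))

    ∑-*ʳ : ∀ (xs : List A) c (f : A → ℤ) → ∑ xs (λ x → f x * c) ≡ ∑ xs f * c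
    ∑-*ʳ []       c f = refl
    ∑-*ʳ (x ∷ xs) c f rewrite ∑-*ʳ xs c f = sym (ℤₚ.*-distribʳ-+ c (f x) (∑ xs f))

    ∑-const : ∀ (xs : List A) c → ∑ xs (λ _ → c) ≡ + length xs * c
    ∑-const []       c = refl
    ∑-const (x ∷ xs) c rewrite ∑-const xs c = sym (ℤₚ.suc-* (+ length xs) c)

    ∑-++ : ∀ (xs ys : List A) f → ∑ (xs ++ ys) f ≡ ∑ xs f + ∑ ys f
    ∑-++ []       ys f = sym (ℤₚ.+-identityˡ _)
    ∑-++ (x ∷ xs) ys f rewrite ∑-++ xs ys f = sym (ℤₚ.+-assoc (f x) _ _)

    term≤∑ : ∀ {xs : List A} {x} {f : A → ℤ} → (∀ y → 0ℤ ≤ f y) → x ∈ xs → f x ≤ ∑ xs f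
    term≤∑ {_ ∷ xs} {x} {f} f≥0 (here refl) =
      subst (_≤ f x + ∑ xs f) (ℤₚ.+-identityʳ (f x)) (ℤₚ.+-monoʳ-≤ (f x) (∑-nonneg xs f≥0))
    term≤∑ {y ∷ xs} {f = f} f≥0 (there x∈xs) =
      subst (_≤ f y + ∑ xs f) (ℤₚ.+-identityˡ _) (ℤₚ.+-mono-≤ (f≥0 y) (term≤∑ f≥0 x∈xs))

  ∑-map : ∀ {A B : Set} (g : A → B) xs f → ∑ (map g xs) f ≡ ∑ xs (λ x → f (g x))
  ∑-map g []       f = refl
  ∑-map g (x ∷ xs) f = cong₂ _+_ {x = f (g x)} refl (∑-map g xs f)

  ∑-cartesianProductWith : ∀ {A B C : Set} (g : A → B → C) xs ys f →
    ∑ (cartesianProductWith g xs ys) f ≡ ∑ xs (λ x → ∑ ys (λ y → f (g x y)))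
  ∑-cartesianProductWith g []       ys f = refl
  ∑-cartesianProductWith g (x ∷ xs) ys f = trans (∑-++ (map (g x) ys) _ f)
    (cong₂ _+_ (∑-map (g x) ys f) (∑-cartesianProductWith g xs ys f))

  ∑-swap : ∀ {A B : Set} (xs : List A) (ys : List B) (f : A → B → ℤ) →
    ∑ xs (λ x → ∑ ys (λ y → f x y)) ≡ ∑ ys (λ y → ∑ xs (λ x → f x y))
  ∑-swap []       ys f = sym (∑-0 ys)
  ∑-swap (x ∷ xs) ys f rewrite ∑-swap xs ys f = sym (∑-+ ys (f x) _)

  ∑∑-product : ∀ {A B : Set} (xs : List A) (ys : List B) f g →
    ∑ xs (λ x → ∑ ys (λ y → f x * g y)) ≡ ∑ xs f * ∑ ys g
  ∑∑-product xs ys f g = trans (∑-cong xs (λ x → ∑-*ˡ ys (f x) g)) (∑-*ʳ xs (∑ ys g) f)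

  0≤i*i : ∀ i → 0ℤ ≤ i * i
  0≤i*i (+ n)    = subst (0ℤ ≤_) (ℤₚ.pos-* n n) (+≤+ ℕ.z≤n)
  0≤i*i -[1+ n ] = +≤+ ℕ.z≤n

  0≤* : ∀ {i j} → 0ℤ ≤ i → 0ℤ ≤ j → 0ℤ ≤ i * j
  0≤* {i} {j} 0≤i 0≤j = subst (_≤ i * j) (ℤₚ.*-zeroʳ i)
    (ℤₚ.*-monoˡ-≤-nonNeg i {{nonNegative 0≤i}} 0≤j)

  -- Both sides of  0 ≤ ∑ (v − f)²,  with the square expanded.
  variance : ∀ {A : Set} (xs : List A) (f : A → ℤ) v →
    (v * ∑ xs f) + (v * ∑ xs f) ≤ + length xs * (v * v) + ∑ xs (λ x → f x * f x)
  variance []       f v rewrite ℤₚ.*-zeroʳ v = ℤₚ.≤-refl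
  variance (x ∷ xs) f v = ℤₚ.0≤i-j⇒j≤i (subst (0ℤ ≤_) (sym (expand v (f x) (∑ xs f) (+ length xs) (∑ xs _)))
    (ℤₚ.+-mono-≤ (0≤i*i (v - f x)) (ℤₚ.i≤j⇒0≤j-i (variance xs f v))))
    where
    expand : ∀ v a s k q → ((1ℤ + k) * (v * v) + (a * a + q)) - (v * (a + s) + v * (a + s))
                         ≡ (v - a) * (v - a) + ((k * (v * v) + q) - (v * s + v * s))
    expand = solve-∀

  -- Induction on the list. Splitting off the head leaves cross terms between its value and the sum
  -- over the tail; `variance` at v = f x absorbs them.
  cauchy-schwarz : ∀ {A : Set} (xs : List A) (f : A → ℤ) →
    ∑ xs f * ∑ xs f ≤ + length xs * ∑ xs (λ x → f x * f x)
  cauchy-schwarz []       f = ℤₚ.≤-refl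
  cauchy-schwarz (x ∷ xs) f = begin
    (a + s) * (a + s)                      ≡⟨ expandˡ a s ⟩
    a * a + (a * s + a * s) + s * s        ≤⟨ ℤₚ.+-mono-≤ (ℤₚ.+-monoʳ-≤ (a * a) (variance xs f a)) (cauchy-schwarz xs f) ⟩
    a * a + (k * (a * a) + q) + k * q      ≡⟨ expandʳ a k q ⟩
    (1ℤ + k) * (a * a + q)                 ∎
    where
    open ℤₚ.≤-Reasoning
    a = f x
    s = ∑ xs f
    k = + length xs
    q = ∑ xs (λ x → f x * f x)
    expandˡ : ∀ a s → (a + s) * (a + s) ≡ a * a + (a * s + a * s) + s * s
    expandˡ = solve-∀
    expandʳ : ∀ a k q → a * a + (k * (a * a) + q) + k * q ≡ (1ℤ + k) * (a * a + q)
    expandʳ = solve-∀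

  -- Discrepancy of cylinder intersections.

  𝟙 : Bool → ℤ
  𝟙 true  = 1ℤ
  𝟙 false = 0ℤ

  0≤𝟙 : ∀ b → 0ℤ ≤ 𝟙 b
  0≤𝟙 true  = +≤+ ℕ.z≤n
  0≤𝟙 false = +≤+ ℕ.z≤n

  𝟙*≤ : ∀ b {i q} → 0ℤ ≤ q → i ≤ q → 𝟙 b * i ≤ q
  𝟙*≤ true  {i} 0≤q i≤q = ℤₚ.≤-trans (ℤₚ.≤-reflexive (ℤₚ.*-identityˡ i)) i≤q
  𝟙*≤ false     0≤q i≤q = 0≤q

  -- One Cauchy–Schwarz step of the discrepancy method: the factor b, which does not
  -- involve the inner variable, is dropped and the inner variable is doubled.
  doubling : ∀ {A C : Set} (as : List A) (cs : List C) (b : A → Bool) (t : A → C → ℤ) →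
    let s = ∑ as (λ a → 𝟙 (b a) * ∑ cs (t a)) in
    s * s ≤ + length as * ∑ cs (λ c → ∑ cs (λ c′ → ∑ as (λ a → t a c * t a c′)))
  doubling as cs b t = begin
    s * s                                              ≤⟨ cauchy-schwarz as _ ⟩
    + length as * ∑ as (λ a → u a * u a)               ≤⟨ ℤₚ.*-monoˡ-≤-nonNeg (+ length as) (∑-mono as u²≤v²) ⟩
    + length as * ∑ as (λ a → v a * v a)               ≡⟨ cong (+ length as *_) regroup ⟩
    + length as * ∑ cs (λ c → ∑ cs (λ c′ → ∑ as (λ a → t a c * t a c′))) ∎
    where
    open ℤₚ.≤-Reasoning
    v = λ a → ∑ cs (t a)
    u = λ a → 𝟙 (b a) * v a
    s = ∑ as u
    u²≤v² : ∀ a → u a * u a ≤ v a * v a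
    u²≤v² a with b a
    ... | true  = ℤₚ.≤-reflexive (cong₂ _*_ (ℤₚ.*-identityˡ (v a)) (ℤₚ.*-identityˡ (v a)))
    ... | false = 0≤i*i (v a)
    regroup : ∑ as (λ a → v a * v a) ≡ ∑ cs (λ c → ∑ cs (λ c′ → ∑ as (λ a → t a c * t a c′)))
    regroup = trans (∑-cong as (λ a → sym (∑∑-product cs cs (t a) (t a))))
             (trans (∑-swap as cs (λ a c → ∑ cs (λ c′ → t a c * t a c′)))
                      (∑-cong cs (λ c → ∑-swap as cs (λ a c′ → t a c * t a c′))))

  square-mono : ∀ {i j} → 0ℤ ≤ i → i ≤ j → i * i ≤ j * j
  square-mono {i} {j} 0≤i i≤j = ℤₚ.≤-trans
    (ℤₚ.*-monoˡ-≤-nonNeg i {{nonNegative 0≤i}} i≤j)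
    (ℤₚ.*-monoʳ-≤-nonNeg j {{nonNegative (ℤₚ.≤-trans 0≤i i≤j)}} i≤j)

  𝟙-∧ : ∀ a b → 𝟙 (a ∧ b) ≡ 𝟙 a * 𝟙 b
  𝟙-∧ true  b = sym (ℤₚ.*-identityˡ (𝟙 b))
  𝟙-∧ false b = refl

  -- The cylinder intersection is given by `f`, `g`, `h`, each blind to one coordinate. The function
  -- `q` bounds the sum over z of the product of χ at the four corners of a rectangle, which is what
  -- survives after x and then y have been doubled.
  module Discrepancy {X Y Z : Set} (xs : List X) (ys : List Y) (zs : List Z)
    (χ : X → Y → Z → ℤ) (q : X → X → Y → Y → ℤ)
    (0≤q : ∀ x x′ y y′ → 0ℤ ≤ q x x′ y y′)
    (∑χ≤q : ∀ x x′ y y′ → ∑ zs (λ z → (χ x y z * χ x′ y z) * (χ x y′ z * χ x′ y′ z)) ≤ q x x′ y y′)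
    (f : X → Y → Bool) (g : Y → Z → Bool) (h : X → Z → Bool) where

    yzs : List (Y × Z)
    yzs = cartesianProduct ys zs

    xxzs : List (X × X × Z)
    xxzs = cartesianProduct xs (cartesianProduct xs zs)

    correlation : ℤ
    correlation = ∑ yzs (λ (y , z) → 𝟙 (g y z) * ∑ xs (λ x → (𝟙 (f x y) * 𝟙 (h x z)) * χ x y z))

    private
      t₁ : Y × Z → X → ℤ
      t₁ (y , z) x = (𝟙 (f x y) * 𝟙 (h x z)) * χ x y z

      -- The first doubling removes `g` and doubles x. Of the surviving factors, those without y are
      -- split off into `b₂`, to be removed when y is doubled in turn.
      t₂ : X × X × Z → Y → ℤ
      t₂ (x , x′ , z) y = (𝟙 (f x y) * 𝟙 (f x′ y)) * (χ x y z * χ x′ y z)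

      b₂ : X × X × Z → Bool
      b₂ (x , x′ , z) = h x z ∧ h x′ z

      E : ℤ
      E = ∑ xxzs (λ a → 𝟙 (b₂ a) * ∑ ys (t₂ a))

      regroup : ∑ xs (λ x → ∑ xs (λ x′ → ∑ yzs (λ a → t₁ a x * t₁ a x′))) ≡ E
      regroup = trans (∑-cong xs (λ x → trans (∑-cong xs (inner x)) (sym (∑-cartesianProductWith _,_ xs zs _))))
                      (sym (∑-cartesianProductWith _,_ xs (cartesianProduct xs zs) _))
        where
        rearrange : ∀ f h c f′ h′ c′ → ((f * h) * c) * ((f′ * h′) * c′) ≡ (h * h′) * ((f * f′) * (c * c′))
        rearrange = solve-∀
        inner : ∀ x x′ → ∑ yzs (λ a → t₁ a x * t₁ a x′) ≡ ∑ zs (λ z → 𝟙 (b₂ (x , x′ , z)) * ∑ ys (t₂ (x , x′ , z)))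
        inner x x′ = begin
          ∑ yzs (λ a → t₁ a x * t₁ a x′)
            ≡⟨ ∑-cartesianProductWith _,_ ys zs _ ⟩
          ∑ ys (λ y → ∑ zs (λ z → t₁ (y , z) x * t₁ (y , z) x′))
            ≡⟨ ∑-swap ys zs (λ y z → t₁ (y , z) x * t₁ (y , z) x′) ⟩
          ∑ zs (λ z → ∑ ys (λ y → t₁ (y , z) x * t₁ (y , z) x′))
            ≡⟨ ∑-cong zs (λ z → trans
                 (∑-cong ys (λ y → trans
                   (rearrange (𝟙 (f x y)) (𝟙 (h x z)) (χ x y z) (𝟙 (f x′ y)) (𝟙 (h x′ z)) (χ x′ y z))
                   (cong (_* t₂ (x , x′ , z) y) (sym (𝟙-∧ (h x z) (h x′ z))))))
                 (∑-*ˡ ys (𝟙 (b₂ (x , x′ , z))) (t₂ (x , x′ , z)))) ⟩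
          ∑ zs (λ z → 𝟙 (b₂ (x , x′ , z)) * ∑ ys (t₂ (x , x′ , z))) ∎
          where open ≡-Reasoning

      -- With x and y both doubled, the surviving indicators all come from `f` and do not involve z.
      -- They leave the sum over z as a factor 0 or 1, which preserves the bound by `q` because `q`
      -- is nonnegative.
      inner≤q : ∀ y y′ → ∑ xxzs (λ a → t₂ a y * t₂ a y′) ≤ ∑ xs (λ x → ∑ xs (λ x′ → q x x′ y y′))
      inner≤q y y′ = ℤₚ.≤-trans
        (ℤₚ.≤-reflexive (trans (∑-cartesianProductWith _,_ xs (cartesianProduct xs zs) _)
                               (∑-cong xs (λ x → ∑-cartesianProductWith _,_ xs zs _))))
        (∑-mono xs (λ x → ∑-mono xs (bound x)))
        where
        rearrange : ∀ a b c a′ b′ c′ → ((a * b) * c) * ((a′ * b′) * c′) ≡ (a * (b * (a′ * b′))) * (c * c′)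
        rearrange = solve-∀
        reassoc : ∀ a b c d s → (a * (b * (c * d))) * s ≡ a * (b * (c * (d * s)))
        reassoc = solve-∀
        bound : ∀ x x′ → ∑ zs (λ z → t₂ (x , x′ , z) y * t₂ (x , x′ , z) y′) ≤ q x x′ y y′
        bound x x′ = ℤₚ.≤-trans
          (ℤₚ.≤-reflexive (trans
            (∑-cong zs (λ z → rearrange (𝟙 (f x y)) (𝟙 (f x′ y)) (χ x y z * χ x′ y z)
                                        (𝟙 (f x y′)) (𝟙 (f x′ y′)) (χ x y′ z * χ x′ y′ z)))
            (trans (∑-*ˡ zs (𝟙 (f x y) * (𝟙 (f x′ y) * (𝟙 (f x y′) * 𝟙 (f x′ y′)))) _)
                   (reassoc (𝟙 (f x y)) (𝟙 (f x′ y)) (𝟙 (f x y′)) (𝟙 (f x′ y′)) _))))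
          (𝟙*≤ (f x y) p (𝟙*≤ (f x′ y) p (𝟙*≤ (f x y′) p (𝟙*≤ (f x′ y′) p (∑χ≤q x x′ y y′)))))
          where p = 0≤q x x′ y y′

    -- The first doubling gives D² ≤ N₁E and the second E² ≤ N₂W. Squaring the former and inserting
    -- the latter bounds D⁴.
    correlation-bound : (correlation * correlation) * (correlation * correlation)
      ≤ (+ length yzs * + length yzs) *
        (+ length xxzs * ∑ ys (λ y → ∑ ys (λ y′ → ∑ xs (λ x → ∑ xs (λ x′ → q x x′ y y′)))))
    correlation-bound = begin
      (D * D) * (D * D)              ≤⟨ square-mono (0≤i*i D) D²≤ ⟩
      (N₁ * E) * (N₁ * E)            ≡⟨ rearrange N₁ E ⟩
      (N₁ * N₁) * (E * E)            ≤⟨ ℤₚ.*-monoˡ-≤-nonNeg (N₁ * N₁) {{nonNegative (0≤i*i N₁)}} E²≤ ⟩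
      (N₁ * N₁) * (N₂ * W)           ∎
      where
      open ℤₚ.≤-Reasoning
      D = correlation
      N₁ = + length yzs
      N₂ = + length xxzs
      W = ∑ ys (λ y → ∑ ys (λ y′ → ∑ xs (λ x → ∑ xs (λ x′ → q x x′ y y′))))
      rearrange : ∀ n e → (n * e) * (n * e) ≡ (n * n) * (e * e)
      rearrange = solve-∀
      D²≤ : D * D ≤ N₁ * E
      D²≤ = subst (λ e → D * D ≤ N₁ * e) regroup (doubling yzs xs (λ (y , z) → g y z) t₁)
      E²≤ : E * E ≤ N₂ * W
      E²≤ = ℤₚ.≤-trans (doubling xxzs ys b₂ t₂)
        (ℤₚ.*-monoˡ-≤-nonNeg N₂ (∑-mono ys (λ y → ∑-mono ys (inner≤q y))))

  -- Sums over spaces of vectors, coordinate by coordinate.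

  vecs : {A : Set} → List A → ∀ m → List (Vec A m)
  vecs as zero    = [] ∷ []
  vecs as (suc m) = cartesianProductWith _∷_ as (vecs as m)

  length-cartesianProductWith : ∀ {A B C : Set} (g : A → B → C) xs ys →
    length (cartesianProductWith g xs ys) ≡ length xs ℕ.* length ys
  length-cartesianProductWith g []       ys = refl
  length-cartesianProductWith g (x ∷ xs) ys = trans (Listₚ.length-++ (map (g x) ys))
    (cong₂ ℕ._+_ (Listₚ.length-map (g x) ys) (length-cartesianProductWith g xs ys))

  module _ {A : Set} (as : List A) where

    length-vecs : ∀ m → length (vecs as m) ≡ length as ℕ.^ m
    length-vecs zero    = refl
    length-vecs (suc m) = trans (length-cartesianProductWith _∷_ as (vecs as m))
                                (cong (length as ℕ.*_) (length-vecs m))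

    ∈-vecs : (∀ a → a ∈ as) → ∀ {m} (v : Vec A m) → v ∈ vecs as m
    ∈-vecs all []      = here refl
    ∈-vecs all (a ∷ v) = ∈-cartesianProductWith⁺ _∷_ (all a) (∈-vecs all v)

    -- Sums of product functions factor over the coordinates. This is how every count for m blocks
    -- is obtained from the count for one block.
    ∑-vecs-suc : ∀ {m} {F : Vec A (suc m) → ℤ} {φ : A → ℤ} {G : Vec A m → ℤ} →
      (∀ a v → F (a ∷ v) ≡ φ a * G v) →
      ∑ (vecs as (suc m)) F ≡ ∑ as φ * ∑ (vecs as m) G
    ∑-vecs-suc {m} {F} {φ} {G} e = trans (∑-cartesianProductWith _∷_ as (vecs as m) F)
      (trans (∑-cong as (λ a → ∑-cong (vecs as m) (e a))) (∑∑-product as (vecs as m) φ G))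

  bools : List Bool
  bools = false ∷ true ∷ []

  ∈-bools : ∀ b → b ∈ bools
  ∈-bools false = here refl
  ∈-bools true  = there (here refl)

  -- Flipping coordinate i is a sign-reversing involution.
  ∑-alternating : ∀ {k} (i : Fin k) (F : Vec Bool k → ℤ) →
    (∀ v → F (v [ i ]%= not) ≡ - F v) → ∑ (vecs bools k) F ≡ 0ℤ
  ∑-alternating {suc k} zero F alt = trans (∑-cartesianProductWith _∷_ bools (vecs bools k) F)
    (trans (cong (λ t → ∑ (vecs bools k) (λ v → F (false ∷ v)) + t) (ℤₚ.+-identityʳ (∑ (vecs bools k) (λ v → F (true ∷ v)))))
    (trans (sym (∑-+ (vecs bools k) _ _))
    (trans (∑-cong (vecs bools k) (λ v → trans (cong (λ t → F (false ∷ v) + t) (alt (false ∷ v))) (ℤₚ.+-inverseʳ (F (false ∷ v)))))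
           (∑-0 (vecs bools k)))))
  ∑-alternating {suc k} (suc i) F alt = trans (∑-cartesianProductWith _∷_ bools (vecs bools k) F)
    (trans (∑-cong bools (λ b → ∑-alternating i (λ v → F (b ∷ v)) (λ v → alt (b ∷ v)))) (∑-0 bools))

  sgn : Bool → ℤ
  sgn false = 1ℤ
  sgn true  = -1ℤ

  sgn² : ∀ b → sgn b * sgn b ≡ 1ℤ
  sgn² false = refl
  sgn² true  = refl

  sgn-not : ∀ b → sgn (not b) ≡ - sgn b
  sgn-not false = refl
  sgn-not true  = refl

  ∑-tabulate-suc : ∀ {r} (f : Fin (suc r) → ℤ) → ∑ (tabulateˡ Fin.suc) f ≡ ∑ (allFin r) (λ j → f (Fin.suc j))
  ∑-tabulate-suc {r} f = trans (cong (λ l → ∑ l f) (sym (Listₚ.map-tabulate (λ i → i) Fin.suc)))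
                               (∑-map Fin.suc (allFin r) f)

  ∑-𝟙-≟ : ∀ {r} (i : Fin r) → ∑ (allFin r) (λ j → 𝟙 (does (i ≟ j))) ≡ 1ℤ
  ∑-𝟙-≟ {suc r} zero    = cong (λ t → 1ℤ + t)
    (trans (∑-tabulate-suc {r} (λ j → 𝟙 (does (Fin.zero ≟ j)))) (∑-0 (allFin r)))
  ∑-𝟙-≟ {suc r} (suc i) = trans (ℤₚ.+-identityˡ _)
    (trans (∑-tabulate-suc {r} (λ j → 𝟙 (does (Fin.suc i ≟ j)))) (∑-𝟙-≟ i))

  *-mono-≤-nonneg : ∀ {a a′ b b′} → 0ℤ ≤ a → 0ℤ ≤ b → a ≤ a′ → b ≤ b′ → a * b ≤ a′ * b′
  *-mono-≤-nonneg {a} {a′} {b} {b′} 0≤a 0≤b a≤ b≤ = ℤₚ.≤-trans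
    (ℤₚ.*-monoˡ-≤-nonNeg a {{nonNegative 0≤a}} b≤)
    (ℤₚ.*-monoʳ-≤-nonNeg b′ {{nonNegative (ℤₚ.≤-trans 0≤b b≤)}} a≤)

  -- Pointers into tables of bits: intact instances and the sign χ.

  module Pointers (r : ℕ) where

    -- The r × r table is kept as a flat vector, so that flipping one cell is flipping one
    -- coordinate and `∑-alternating` applies.
    Block : Set
    Block = Vec Bool (r ℕ.* r)

    blocks : List Block
    blocks = vecs bools (r ℕ.* r)

    cell : Fin r → Fin r → Block → Bool
    cell s t z = lookup z (combine s t)

    flip-≢ : ∀ s t s′ t′ z → ¬ (s ≡ s′ × t ≡ t′) → cell s′ t′ (z [ combine s t ]%= not) ≡ cell s′ t′ z
    flip-≢ s t s′ t′ z ne = Vecₚ.lookup∘updateAt′ (combine s′ t′) (combine s t)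
      (λ e → ne (let p , q = Finₚ.combine-injective s′ t′ s t e in sym p , sym q)) z

    flip-≡ : ∀ s t z → cell s t (z [ combine s t ]%= not) ≡ not (cell s t z)
    flip-≡ s t z = Vecₚ.lookup∘updateAt (combine s t) z

    B : ℤ
    B = + length blocks

    rectangle : Fin r → Fin r → Fin r → Fin r → Block → ℤ
    rectangle x x′ y y′ z = (sgn (cell x y z) * sgn (cell x′ y z)) * (sgn (cell x y′ z) * sgn (cell x′ y′ z))

    -- Bounds the indicator of x ≡ x′ or y ≡ y′; the rectangle sum cancels in all other cases.
    degenerate : Fin r → Fin r → Fin r → Fin r → ℤ
    degenerate x x′ y y′ = 𝟙 (does (y ≟ y′)) + 𝟙 (does (x ≟ x′))

    -- If y = y′ or x = x′, the corners coincide in pairs and all signs are squared. Otherwise the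
    -- cell (x, y) is a single corner, and flipping its bit cancels the sum. The lower bound is kept
    -- because the bounds of separate blocks get multiplied.
    ∑-rectangle : ∀ x x′ y y′ → let b = ∑ blocks (rectangle x x′ y y′) in
      (0ℤ ≤ b) × (b ≤ B * degenerate x x′ y y′)
    ∑-rectangle x x′ y y′ with y ≟ y′ | x ≟ x′
    ... | yes refl | d = subst (λ b → (0ℤ ≤ b) × (b ≤ B * (1ℤ + 𝟙 (does d)))) (sym full)
        (+≤+ ℕ.z≤n , ℤₚ.≤-trans (ℤₚ.≤-reflexive (sym (ℤₚ.*-identityʳ B)))
                       (ℤₚ.*-monoˡ-≤-nonNeg B (ℤₚ.+-monoʳ-≤ 1ℤ (0≤𝟙 (does d)))))
      where
      shuffle : ∀ a b → (a * b) * (a * b) ≡ (a * a) * (b * b)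
      shuffle = solve-∀
      full : ∑ blocks (rectangle x x′ y y) ≡ B
      full = trans (∑-cong blocks (λ z → trans (shuffle (sgn (cell x y z)) (sgn (cell x′ y z)))
                     (cong₂ _*_ (sgn² (cell x y z)) (sgn² (cell x′ y z)))))
                   (trans (∑-const blocks 1ℤ) (ℤₚ.*-identityʳ B))
    ... | no y≢y′ | yes refl = subst (λ b → (0ℤ ≤ b) × (b ≤ B * 1ℤ)) (sym full)
        (+≤+ ℕ.z≤n , ℤₚ.≤-reflexive (sym (ℤₚ.*-identityʳ B)))
      where
      full : ∑ blocks (rectangle x x y y′) ≡ B
      full = trans (∑-cong blocks (λ z → cong₂ _*_ (sgn² (cell x y z)) (sgn² (cell x y′ z))))
                   (trans (∑-const blocks 1ℤ) (ℤₚ.*-identityʳ B))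
    ... | no y≢y′ | no x≢x′ = subst (λ b → (0ℤ ≤ b) × (b ≤ B * 0ℤ)) (sym cancel)
        (ℤₚ.≤-refl , ℤₚ.≤-reflexive (sym (ℤₚ.*-zeroʳ B)))
      where
      negate : ∀ a b c → (- a * b) * c ≡ - ((a * b) * c)
      negate = solve-∀
      cancel : ∑ blocks (rectangle x x′ y y′) ≡ 0ℤ
      cancel = ∑-alternating (combine x y) _ (λ z → trans
        (cong₂ _*_
          (cong₂ _*_ (trans (cong sgn (flip-≡ x y z)) (sgn-not (cell x y z)))
                     (cong sgn (flip-≢ x y x′ y z (λ e → x≢x′ (proj₁ e)))))
          (cong₂ _*_ (cong sgn (flip-≢ x y x y′ z (λ e → y≢y′ (proj₂ e))))
                     (cong sgn (flip-≢ x y x′ y′ z (λ e → x≢x′ (proj₁ e))))))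
        (negate (sgn (cell x y z)) _ _))

    -- Twice the indicator of an unset bit is 1 plus its sign, and the signs cancel when that bit is
    -- flipped. The factor 2 on the left avoids a division.
    ∑-𝟙-cell : ∀ x y → ∑ blocks (λ z → 𝟙 (not (cell x y z))) * (+ 2) ≡ B
    ∑-𝟙-cell x y = begin
      ∑ blocks (λ z → 𝟙 (not (cell x y z))) * (+ 2)       ≡⟨ sym (∑-*ʳ blocks (+ 2) _) ⟩
      ∑ blocks (λ z → 𝟙 (not (cell x y z)) * (+ 2))       ≡⟨ ∑-cong blocks (λ z → half (cell x y z)) ⟩
      ∑ blocks (λ z → 1ℤ + sgn (cell x y z))              ≡⟨ ∑-+ blocks (λ _ → 1ℤ) _ ⟩
      ∑ blocks (λ _ → 1ℤ) + ∑ blocks (λ z → sgn (cell x y z))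
        ≡⟨ cong₂ _+_ (trans (∑-const blocks 1ℤ) (ℤₚ.*-identityʳ B)) (∑-alternating (combine x y) _
             (λ z → trans (cong sgn (flip-≡ x y z)) (sgn-not (cell x y z)))) ⟩
      B + 0ℤ                                              ≡⟨ ℤₚ.+-identityʳ B ⟩
      B                                                   ∎
      where
      open ≡-Reasoning
      half : ∀ b → 𝟙 (not b) * (+ 2) ≡ 1ℤ + sgn b
      half false = refl
      half true  = refl

    Ptrs : ℕ → Set
    Ptrs = Vec (Fin r)

    Tables : ℕ → Set
    Tables = Vec Block

    ptrs : ∀ m → List (Ptrs m)
    ptrs = vecs (allFin r)

    tables : ∀ m → List (Tables m)
    tables = vecs blocks

    ok : ∀ {m} → Ptrs m → Ptrs m → Tables m → Bool
    ok []       []       []       = true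
    ok (x ∷ xs) (y ∷ ys) (z ∷ zs) = not (cell x y z) ∧ ok xs ys zs

    χ : ∀ {m} → Ptrs m → Ptrs m → Tables m → ℤ
    χ []       []       []       = 1ℤ
    χ (x ∷ xs) (y ∷ ys) (z ∷ zs) = sgn (cell x y z) * χ xs ys zs

    ok⇒χ≡1 : ∀ {m} (xs ys : Ptrs m) zs → ok xs ys zs ≡ true → χ xs ys zs ≡ 1ℤ
    ok⇒χ≡1 []       []       []       _ = refl
    ok⇒χ≡1 (x ∷ xs) (y ∷ ys) (z ∷ zs) e with cell x y z
    ... | false = trans (ℤₚ.*-identityˡ _) (ok⇒χ≡1 xs ys zs e)

    degenerates : ∀ {m} → Ptrs m → Ptrs m → Ptrs m → Ptrs m → ℤ
    degenerates []       []         []       []         = 1ℤ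
    degenerates (x ∷ xs) (x′ ∷ xs′) (y ∷ ys) (y′ ∷ ys′) = degenerate x x′ y y′ * degenerates xs xs′ ys ys′

    0≤degenerates : ∀ {m} (xs xs′ ys ys′ : Ptrs m) → 0ℤ ≤ degenerates xs xs′ ys ys′
    0≤degenerates []       []         []       []         = +≤+ ℕ.z≤n
    0≤degenerates (x ∷ xs) (x′ ∷ xs′) (y ∷ ys) (y′ ∷ ys′) =
      0≤* (ℤₚ.+-mono-≤ (0≤𝟙 (does (y ≟ y′))) (0≤𝟙 (does (x ≟ x′)))) (0≤degenerates xs xs′ ys ys′)

    +length-tables : ∀ m → + length (tables (suc m)) ≡ B * + length (tables m)
    +length-tables m = trans (cong +_ (length-cartesianProductWith _∷_ blocks (tables m)))
                             (ℤₚ.pos-* (length blocks) _)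

    -- The blocks are independent, so the sum is a product over them. Multiplying the upper bounds
    -- uses the lower bounds.
    ∑-rectangles : ∀ {m} (xs xs′ ys ys′ : Ptrs m) →
      let b = ∑ (tables m) (λ zs → (χ xs ys zs * χ xs′ ys zs) * (χ xs ys′ zs * χ xs′ ys′ zs)) in
      (0ℤ ≤ b) × (b ≤ + length (tables m) * degenerates xs xs′ ys ys′)
    ∑-rectangles []       []         []       []         = +≤+ ℕ.z≤n , ℤₚ.≤-refl
    ∑-rectangles {suc m} (x ∷ xs) (x′ ∷ xs′) (y ∷ ys) (y′ ∷ ys′) =
      let 0≤b , b≤ = ∑-rectangle x x′ y y′
          0≤c , c≤ = ∑-rectangles xs xs′ ys ys′
          split = ∑-vecs-suc blocks {m} {φ = rectangle x x′ y y′}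
                    (λ z zs → shuffle (sgn (cell x y z)) (χ xs ys zs) (sgn (cell x′ y z)) (χ xs′ ys zs)
                                      (sgn (cell x y′ z)) (χ xs ys′ zs) (sgn (cell x′ y′ z)) (χ xs′ ys′ zs))
      in subst (0ℤ ≤_) (sym split) (0≤* 0≤b 0≤c)
       , ℤₚ.≤-trans (ℤₚ.≤-reflexive split) (ℤₚ.≤-trans (*-mono-≤-nonneg 0≤b 0≤c b≤ c≤) (ℤₚ.≤-reflexive
           (trans (swap-middle B (degenerate x x′ y y′) (+ length (tables m)) _)
                  (cong (_* (degenerate x x′ y y′ * degenerates xs xs′ ys ys′)) (sym (+length-tables m))))))
      where
      shuffle : ∀ a a′ b b′ c c′ d d′ →
        ((a * a′) * (b * b′)) * ((c * c′) * (d * d′)) ≡ ((a * b) * (c * d)) * ((a′ * b′) * (c′ * d′))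
      shuffle = solve-∀
      swap-middle : ∀ a b c d → (a * b) * (c * d) ≡ (a * c) * (b * d)
      swap-middle = solve-∀

    ∑-ok : ∀ {m} (xs ys : Ptrs m) → ∑ (tables m) (λ zs → 𝟙 (ok xs ys zs)) * + (2 ℕ.^ m) ≡ + length (tables m)
    ∑-ok []       []       = refl
    ∑-ok {suc m} (x ∷ xs) (y ∷ ys) = begin
      ∑ (tables (suc m)) (λ zs → 𝟙 (ok (x ∷ xs) (y ∷ ys) zs)) * + (2 ℕ.^ suc m)
        ≡⟨ cong₂ _*_ (∑-vecs-suc blocks {m} (λ z zs → 𝟙-∧ (not (cell x y z)) (ok xs ys zs))) (ℤₚ.pos-* 2 (2 ℕ.^ m)) ⟩
      (s * t) * (+ 2 * + (2 ℕ.^ m))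
        ≡⟨ swap-middle s t (+ 2) (+ (2 ℕ.^ m)) ⟩
      (s * + 2) * (t * + (2 ℕ.^ m))
        ≡⟨ cong₂ _*_ (∑-𝟙-cell x y) (∑-ok xs ys) ⟩
      B * + length (tables m)
        ≡⟨ sym (+length-tables m) ⟩
      + length (tables (suc m)) ∎
      where
      open ≡-Reasoning
      s = ∑ blocks (λ z → 𝟙 (not (cell x y z)))
      t = ∑ (tables m) (λ zs → 𝟙 (ok xs ys zs))
      swap-middle : ∀ a b c d → (a * b) * (c * d) ≡ (a * c) * (b * d)
      swap-middle = solve-∀

    -- What `degenerate` becomes after summation over x′; the result is the same for every x.
    degree : Fin r → Fin r → ℤ
    degree y y′ = + r * 𝟙 (does (y ≟ y′)) + 1ℤ

    degrees : ∀ {m} → Ptrs m → Ptrs m → ℤ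
    degrees []       []         = 1ℤ
    degrees (y ∷ ys) (y′ ∷ ys′) = degree y y′ * degrees ys ys′

    length-allFin : length (allFin r) ≡ r
    length-allFin = Listₚ.length-tabulate (λ i → i)

    ∑-degenerate : ∀ x y y′ → ∑ (allFin r) (λ x′ → degenerate x x′ y y′) ≡ degree y y′
    ∑-degenerate x y y′ = trans (∑-+ (allFin r) (λ _ → 𝟙 (does (y ≟ y′))) _)
      (cong₂ _+_ (trans (∑-const (allFin r) _) (cong (λ l → + l * 𝟙 (does (y ≟ y′))) length-allFin)) (∑-𝟙-≟ x))

    ∑-degenerates : ∀ {m} (xs ys ys′ : Ptrs m) → ∑ (ptrs m) (λ xs′ → degenerates xs xs′ ys ys′) ≡ degrees ys ys′
    ∑-degenerates []       []       []         = refl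
    ∑-degenerates {suc m} (x ∷ xs) (y ∷ ys) (y′ ∷ ys′) =
      trans (∑-vecs-suc (allFin r) {m} (λ _ _ → refl)) (cong₂ _*_ (∑-degenerate x y y′) (∑-degenerates xs ys ys′))

    -- Here lies the gain of the method: among the r² choices of x′ and y′ the total weight is only
    -- 2r, a factor 2/r per block.
    ∑-degree : ∀ y → ∑ (allFin r) (degree y) ≡ + (2 ℕ.* r)
    ∑-degree y = trans (∑-+ (allFin r) (λ y′ → + r * 𝟙 (does (y ≟ y′))) (λ _ → 1ℤ))
      (trans (cong₂ _+_ (trans (∑-*ˡ (allFin r) (+ r) _) (trans (cong (+ r *_) (∑-𝟙-≟ y)) (ℤₚ.*-identityʳ (+ r))))
                        (trans (∑-const (allFin r) 1ℤ) (trans (ℤₚ.*-identityʳ _) (cong +_ length-allFin))))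
      (cong +_ (cong (r ℕ.+_) (sym (ℕₚ.+-identityʳ r)))))

    ∑-degrees : ∀ {m} (ys : Ptrs m) → ∑ (ptrs m) (degrees ys) ≡ + ((2 ℕ.* r) ℕ.^ m)
    ∑-degrees []       = refl
    ∑-degrees {suc m} (y ∷ ys) = trans (∑-vecs-suc (allFin r) {m} (λ _ _ → refl))
      (trans (cong₂ _*_ (∑-degree y) (∑-degrees ys)) (sym (ℤₚ.pos-* (2 ℕ.* r) _)))

  -- Number-on-forehead protocols and their covers by cylinder intersections.

  data Step (X Y Z S : Set) : Set where
    stepA : (Y → Z → S → S) → Step X Y Z S
    stepB : (X → Z → S → S) → Step X Y Z S
    stepC : (X → Y → S → S) → Step X Y Z S

  apply : ∀ {X Y Z S} → X → Y → Z → S → Step X Y Z S → S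
  apply x y z st (stepA F) = F y z st
  apply x y z st (stepB F) = F x z st
  apply x y z st (stepC F) = F x y st

  exec : ∀ {X Y Z S} → List (Step X Y Z S) → S → X → Y → Z → S
  exec ks st x y z = foldl (apply x y z) st ks

  module Cover {X Y Z S : Set} (xs : List X) (ys : List Y) (zs : List Z)
    (ok : X → Y → Z → Bool) (states : List S) (∈-states : ∀ st → st ∈ states)
    (_≟ˢ_ : DecidableEquality S) (out : S → Bool) where

    -- The order of summation is that of `correlation`, so that the two can be compared term by
    -- term.
    ∑-inputs : (X → Y → Z → ℤ) → ℤ
    ∑-inputs F = ∑ (cartesianProduct ys zs) (λ (y , z) → ∑ xs (λ x → F x y z))

    ∑-inputs-mono : ∀ {F G} → (∀ x y z → F x y z ≤ G x y z) → ∑-inputs F ≤ ∑-inputs G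
    ∑-inputs-mono e = ∑-mono (cartesianProduct ys zs) (λ (y , z) → ∑-mono xs (λ x → e x y z))

    ∑-inputs-cong : ∀ {F G} → (∀ x y z → F x y z ≡ G x y z) → ∑-inputs F ≡ ∑-inputs G
    ∑-inputs-cong e = ∑-cong (cartesianProduct ys zs) (λ (y , z) → ∑-cong xs (λ x → e x y z))

    ∑-inputs-swap : ∀ {A : Set} (as : List A) (F : A → X → Y → Z → ℤ) →
      ∑-inputs (λ x y z → ∑ as (λ a → F a x y z)) ≡ ∑ as (λ a → ∑-inputs (F a))
    ∑-inputs-swap as F = trans
      (∑-cong (cartesianProduct ys zs) (λ (y , z) → ∑-swap xs as (λ x a → F a x y z)))
      (∑-swap (cartesianProduct ys zs) as (λ (y , z) a → ∑ xs (λ x → F a x y z)))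

    cylinder : (X → Y → Bool) → (Y → Z → Bool) → (X → Z → Bool) → X → Y → Z → Bool
    cylinder f g h x y z = f x y ∧ (g y z ∧ h x z)

    module _ (M : ℕ) (small : ∀ f g h → (∀ x y z → cylinder f g h x y z ≡ true → ok x y z ≡ true) →
                               ∑-inputs (λ x y z → 𝟙 (cylinder f g h x y z)) ≤ + M) where

      accepted : List (Step X Y Z S) → S → X → Y → Z → Bool
      accepted ks st x y z = out (exec ks st x y z)

      -- The cylinder stands for the memory states guessed so far, `a` for acceptance by the
      -- remaining steps.
      Within : (X → Y → Bool) → (Y → Z → Bool) → (X → Z → Bool) → (X → Y → Z → Bool) → Set
      Within f g h a = ∀ x y z → cylinder f g h x y z ∧ a x y z ≡ true → ok x y z ≡ true

      #within : (X → Y → Bool) → (Y → Z → Bool) → (X → Z → Bool) → (X → Y → Z → Bool) → ℤ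
      #within f g h a = ∑-inputs (λ x y z → 𝟙 (cylinder f g h x y z ∧ a x y z))

      -- Guessing the next memory state splits a cylinder into length states cylinders.
      guess : ∀ (b : S → X → Y → Z → Bool) (next : X → Y → Z → S) f g h
        (f′ : S → X → Y → Bool) (g′ : S → Y → Z → Bool) (h′ : S → X → Z → Bool) →
        (∀ s x y z → cylinder (f′ s) (g′ s) (h′ s) x y z ≡ does (next x y z ≟ˢ s) ∧ cylinder f g h x y z) →
        Within f g h (λ x y z → b (next x y z) x y z) →
        ∀ N → (∀ s → Within (f′ s) (g′ s) (h′ s) (b s) → #within (f′ s) (g′ s) (h′ s) (b s) ≤ + (N ℕ.* M)) →
        #within f g h (λ x y z → b (next x y z) x y z) ≤ + ((length states ℕ.* N) ℕ.* M)
      guess b next f g h f′ g′ h′ refine within N bound = begin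
        ∑-inputs (λ x y z → 𝟙 (cyl x y z ∧ b (next x y z) x y z))
          ≤⟨ ∑-inputs-mono (λ x y z → ℤₚ.≤-trans
               (ℤₚ.≤-reflexive (cong (λ d → 𝟙 ((d ∧ cyl x y z) ∧ b (next x y z) x y z))
                                     (sym (dec-true (next x y z ≟ˢ next x y z) refl))))
               (term≤∑ {f = λ s → 𝟙 ((does (next x y z ≟ˢ s) ∧ cyl x y z) ∧ b s x y z)}
                       (λ s → 0≤𝟙 _) (∈-states (next x y z)))) ⟩
        ∑-inputs (λ x y z → ∑ states (λ s → 𝟙 ((does (next x y z ≟ˢ s) ∧ cyl x y z) ∧ b s x y z)))
          ≡⟨ ∑-inputs-swap states (λ s x y z → 𝟙 ((does (next x y z ≟ˢ s) ∧ cyl x y z) ∧ b s x y z)) ⟩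
        ∑ states (λ s → ∑-inputs (λ x y z → 𝟙 ((does (next x y z ≟ˢ s) ∧ cyl x y z) ∧ b s x y z)))
          ≤⟨ ∑-mono states (λ s → ℤₚ.≤-trans
               (ℤₚ.≤-reflexive (∑-inputs-cong (λ x y z → cong (λ d → 𝟙 (d ∧ b s x y z)) (sym (refine s x y z)))))
               (bound s (within′ s))) ⟩
        ∑ states (λ s → + (N ℕ.* M))
          ≡⟨ trans (∑-const states (+ (N ℕ.* M))) (trans (sym (ℤₚ.pos-* (length states) _))
                   (cong +_ (sym (ℕₚ.*-assoc (length states) N M)))) ⟩
        + ((length states ℕ.* N) ℕ.* M) ∎
        where
        open ℤₚ.≤-Reasoning
        cyl : X → Y → Z → Bool
        cyl = cylinder f g h
        within′ : ∀ s → Within (f′ s) (g′ s) (h′ s) (b s)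
        within′ s x y z e rewrite refine s x y z with next x y z ≟ˢ s
        ... | yes refl = within x y z e

      -- Induction on the steps, guessing the state that each one writes. Whether a guess is right
      -- depends, for a step of A, on y and z only, so the test goes into `g`; for B it goes into
      -- `h` and for C into `f`. After the last step the verdict `out st` is a constant, which `f`
      -- absorbs, and `small` applies.
      cover : ∀ ks st f g h → Within f g h (accepted ks st) →
        #within f g h (accepted ks st) ≤ + (length states ℕ.^ length ks ℕ.* M)
      cover [] st f g h within = ℤₚ.≤-trans
        (ℤₚ.≤-reflexive (∑-inputs-cong (λ x y z → cong 𝟙 (push x y z))))
        (ℤₚ.≤-trans (small (λ x y → f x y ∧ out st) g h (λ x y z e → within x y z (trans (push x y z) e)))
                    (ℤₚ.≤-reflexive (cong +_ (sym (ℕₚ.*-identityˡ M)))))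
        where
        reorder : ∀ a b c d → (a ∧ (b ∧ c)) ∧ d ≡ (a ∧ d) ∧ (b ∧ c)
        reorder false b c d = refl
        reorder true  b c d = Boolₚ.∧-comm (b ∧ c) d
        push : ∀ x y z → cylinder f g h x y z ∧ out st ≡ cylinder (λ x y → f x y ∧ out st) g h x y z
        push x y z = reorder (f x y) (g y z) (h x z) (out st)
      cover (stepA F ∷ ks) st f g h within =
        guess (accepted ks) (λ x y z → F y z st) f g h
              (λ s → f) (λ s y z → does (F y z st ≟ˢ s) ∧ g y z) (λ s → h)
              (λ s x y z → reorder (does (F y z st ≟ˢ s)) (f x y) (g y z) (h x z))
              within (length states ℕ.^ length ks)
                (λ s → cover ks s f (λ y z → does (F y z st ≟ˢ s) ∧ g y z) h)
        where
        reorder : ∀ d a b c → a ∧ ((d ∧ b) ∧ c) ≡ d ∧ (a ∧ (b ∧ c))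
        reorder true  a     b c = refl
        reorder false true  b c = refl
        reorder false false b c = refl
      cover (stepB F ∷ ks) st f g h within =
        guess (accepted ks) (λ x y z → F x z st) f g h
              (λ s → f) (λ s → g) (λ s x z → does (F x z st ≟ˢ s) ∧ h x z)
              (λ s x y z → reorder (does (F x z st ≟ˢ s)) (f x y) (g y z) (h x z))
              within (length states ℕ.^ length ks)
                (λ s → cover ks s f g (λ x z → does (F x z st ≟ˢ s) ∧ h x z))
        where
        reorder : ∀ d a b c → a ∧ (b ∧ (d ∧ c)) ≡ d ∧ (a ∧ (b ∧ c))
        reorder true  a     b     c = refl
        reorder false true  true  c = refl
        reorder false true  false c = refl
        reorder false false b     c = refl
      cover (stepC F ∷ ks) st f g h within =
        guess (accepted ks) (λ x y z → F x y st) f g h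
              (λ s x y → does (F x y st ≟ˢ s) ∧ f x y) (λ s → g) (λ s → h)
              (λ s x y z → Boolₚ.∧-assoc (does (F x y st ≟ˢ s)) (f x y) (g y z ∧ h x z))
              within (length states ℕ.^ length ks)
                (λ s → cover ks s (λ x y → does (F x y st ≟ˢ s) ∧ f x y) g h)

  -- Integer fourth roots.

  fourth : ℕ → ℕ
  fourth n = (n ℕ.* n) ℕ.* (n ℕ.* n)

  fourth-mono-≤ : ∀ {m n} → m ℕ.≤ n → fourth m ℕ.≤ fourth n
  fourth-mono-≤ m≤n = ℕₚ.*-mono-≤ (ℕₚ.*-mono-≤ m≤n m≤n) (ℕₚ.*-mono-≤ m≤n m≤n)

  -- The discrepancy method bounds the fourth power of the size of a cylinder intersection, whereas
  -- `Cover` wants a bound on the size itself.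
  fourth-root : ∀ b → ∃ λ M → fourth M ℕ.≤ b × b ℕ.< fourth (suc M)
  fourth-root zero = 0 , ℕ.z≤n , ℕ.s≤s ℕ.z≤n
  fourth-root (suc b) with fourth-root b
  ... | M , lo , hi with suc b ℕ.<? fourth (suc M)
  ...   | yes hi′ = M , ℕₚ.m≤n⇒m≤1+n lo , hi′
  -- In this case (M + 1)⁴ = b + 1, so the root moves up by one.
  ...   | no  hi′ = suc M , ℕₚ.≮⇒≥ hi′ , ℕₚ.<-≤-trans (ℕ.s≤s hi) (square-step (suc M))
    where
    square-step : ∀ n → suc (fourth n) ℕ.≤ fourth (suc n)
    square-step n = ℕₚ.*-mono-< (ℕₚ.*-mono-< (ℕₚ.n<1+n n) (ℕₚ.n<1+n n)) (ℕₚ.*-mono-< (ℕₚ.n<1+n n) (ℕₚ.n<1+n n))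

  ≤-fourth-root : ∀ {c M b} → fourth c ℕ.≤ b → b ℕ.< fourth (suc M) → c ℕ.≤ M
  ≤-fourth-root {c} {M} lo hi = ℕₚ.≮⇒≥ λ M<c → ℕₚ.<⇒≱ hi (ℕₚ.≤-trans (fourth-mono-≤ M<c) lo)

  ^-distribʳ-* : ∀ a b n → (a ℕ.* b) ℕ.^ n ≡ a ℕ.^ n ℕ.* b ℕ.^ n
  ^-distribʳ-* a b zero    = refl
  ^-distribʳ-* a b (suc n) = trans (cong (a ℕ.* b ℕ.*_) (^-distribʳ-* a b n))
                                   (ℕₚ.[m*n]*[o*p]≡[m*o]*[n*p] a b (a ℕ.^ n) (b ℕ.^ n))

  -- The communication lower bound.

  module LowerBound (r : ℕ) .{{_ : NonZero r}} (m : ℕ) {S : Set} (states : List S) (∈-states : ∀ st → st ∈ states)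
    (_≟ˢ_ : DecidableEquality S) (out : S → Bool) where

    open Pointers r

    xs : List (Ptrs m)
    xs = ptrs m

    zs : List (Tables m)
    zs = tables m

    open Cover xs xs zs ok states ∈-states _≟ˢ_ out

    R Z P : ℕ
    R = length xs
    Z = length zs
    P = 2 ℕ.^ m

    R≡ : R ≡ r ℕ.^ m
    R≡ = trans (length-vecs (allFin r) m) (cong (ℕ._^ m) length-allFin)

    instance
      R≢0 : NonZero R
      R≢0 = subst NonZero (sym R≡) (ℕₚ.m^n≢0 r m)

      Z≢0 : NonZero Z
      Z≢0 = subst NonZero (sym (length-vecs blocks m))
        (ℕₚ.m^n≢0 (length blocks) m {{subst NonZero (sym (length-vecs bools (r ℕ.* r))) (ℕₚ.m^n≢0 2 (r ℕ.* r))}})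

    -- The right-hand side of `correlation-bound`: |Y × Z|², then |X × X × Z| times the value of
    -- `∑-q`. It equals R⁷Z⁴P; divided by the fourth power of the number R²Z of inputs, this is P/R
    -- = (2/r)^m.
    b : ℕ
    b = ((R ℕ.* Z) ℕ.* (R ℕ.* Z)) ℕ.* ((R ℕ.* (R ℕ.* Z)) ℕ.* (R ℕ.* (R ℕ.* (Z ℕ.* (P ℕ.* R)))))

    q : Ptrs m → Ptrs m → Ptrs m → Ptrs m → ℤ
    q x x′ y y′ = + Z * degenerates x x′ y y′

    ∑-q : ∑ xs (λ y → ∑ xs (λ y′ → ∑ xs (λ x → ∑ xs (λ x′ → q x x′ y y′)))) ≡ + (R ℕ.* (R ℕ.* (Z ℕ.* (P ℕ.* R))))
    ∑-q = begin
      ∑ xs (λ y → ∑ xs (λ y′ → ∑ xs (λ x → ∑ xs (λ x′ → q x x′ y y′))))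
        ≡⟨ ∑-cong xs (λ y → ∑-cong xs (λ y′ → trans
             (∑-cong xs (λ x → trans (∑-*ˡ xs (+ Z) _) (cong (+ Z *_) (∑-degenerates x y y′))))
             (∑-const xs _))) ⟩
      ∑ xs (λ y → ∑ xs (λ y′ → + R * (+ Z * degrees y y′)))
        ≡⟨ ∑-cong xs (λ y → trans (∑-*ˡ xs (+ R) _) (cong (+ R *_)
             (trans (∑-*ˡ xs (+ Z) _) (cong (+ Z *_) (trans (∑-degrees y) (cong +_ double)))))) ⟩
      ∑ xs (λ y → + R * (+ Z * + (P ℕ.* R)))
        ≡⟨ ∑-const xs _ ⟩
      + R * (+ R * (+ Z * + (P ℕ.* R)))
        ≡⟨ cong (λ t → + R * (+ R * t)) (sym (ℤₚ.pos-* Z _)) ⟩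
      + R * (+ R * + (Z ℕ.* (P ℕ.* R)))
        ≡⟨ cong (+ R *_) (sym (ℤₚ.pos-* R _)) ⟩
      + R * + (R ℕ.* (Z ℕ.* (P ℕ.* R)))
        ≡⟨ sym (ℤₚ.pos-* R _) ⟩
      + (R ℕ.* (R ℕ.* (Z ℕ.* (P ℕ.* R)))) ∎
      where
      open ≡-Reasoning
      double : (2 ℕ.* r) ℕ.^ m ≡ P ℕ.* R
      double = trans (^-distribʳ-* 2 r m) (cong (P ℕ.*_) (sym R≡))

    +fourth : ∀ n → + fourth n ≡ (+ n * + n) * (+ n * + n)
    +fourth n = trans (ℤₚ.pos-* (n ℕ.* n) _) (cong₂ _*_ (ℤₚ.pos-* n n) (ℤₚ.pos-* n n))

    M : ℕ
    M = proj₁ (fourth-root b)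

    module _ (f : Ptrs m → Ptrs m → Bool) (g : Ptrs m → Tables m → Bool) (h : Ptrs m → Tables m → Bool)
      (within : ∀ x y z → cylinder f g h x y z ≡ true → ok x y z ≡ true) where

      open Discrepancy xs xs zs χ q
        (λ x x′ y y′ → 0≤* {+ Z} (+≤+ ℕ.z≤n) (0≤degenerates x x′ y y′))
        (λ x x′ y y′ → proj₂ (∑-rectangles x x′ y y′)) f g h

      size : ℤ
      size = ∑-inputs (λ x y z → 𝟙 (cylinder f g h x y z))

      -- Inside ok the sign χ is constantly 1.
      correlation≡size : correlation ≡ size
      correlation≡size = ∑-cong yzs (λ (y , z) → trans (sym (∑-*ˡ xs (𝟙 (g y z)) _)) (∑-cong xs (λ x → pointwise x y z)))
        where
        pointwise : ∀ x y z → 𝟙 (g y z) * ((𝟙 (f x y) * 𝟙 (h x z)) * χ x y z) ≡ 𝟙 (cylinder f g h x y z)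
        pointwise x y z with f x y | g y z | h x z | within x y z
        ... | true  | true  | true  | w rewrite ok⇒χ≡1 x y z (w refl) = refl
        ... | true  | true  | false | w = refl
        ... | true  | false | _     | w = refl
        ... | false | true  | _     | w = refl
        ... | false | false | _     | w = refl

      size≤M : size ≤ + M
      size≤M = subst (_≤ + M) 0≤size (+≤+ (≤-fourth-root {∣ size ∣} (drop‿+≤+ fourth≤)
                 (proj₂ (proj₂ (fourth-root b)))))
        where
        0≤size : + ∣ size ∣ ≡ size
        0≤size = ℤₚ.0≤i⇒+∣i∣≡i (∑-nonneg yzs (λ (y , z) → ∑-nonneg xs (λ x → 0≤𝟙 _)))
        fourth≤ : + fourth ∣ size ∣ ≤ + b
        fourth≤ = begin
          + fourth ∣ size ∣
            ≡⟨ +fourth ∣ size ∣ ⟩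
          (+ ∣ size ∣ * + ∣ size ∣) * (+ ∣ size ∣ * + ∣ size ∣)
            ≡⟨ cong (λ t → (t * t) * (t * t)) (trans 0≤size (sym correlation≡size)) ⟩
          (correlation * correlation) * (correlation * correlation)
            ≤⟨ correlation-bound ⟩
          (+ length yzs * + length yzs) * (+ length xxzs * _)
            ≡⟨ cong₂ _*_ (trans (cong (λ l → + l * + l) (length-cartesianProductWith _,_ xs zs)) (sym (ℤₚ.pos-* (R ℕ.* Z) _)))
                 (trans (cong₂ _*_ (cong +_ (trans (length-cartesianProductWith _,_ xs (cartesianProduct xs zs))
                                                    (cong (R ℕ.*_) (length-cartesianProductWith _,_ xs zs)))) ∑-q)
                        (sym (ℤₚ.pos-* (R ℕ.* (R ℕ.* Z)) _))) ⟩
          + ((R ℕ.* Z) ℕ.* (R ℕ.* Z)) * + ((R ℕ.* (R ℕ.* Z)) ℕ.* (R ℕ.* (R ℕ.* (Z ℕ.* (P ℕ.* R)))))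
            ≡⟨ sym (ℤₚ.pos-* ((R ℕ.* Z) ℕ.* (R ℕ.* Z)) _) ⟩
          + b ∎
          where open ℤₚ.≤-Reasoning

    -- By `∑-ok`, a fraction 1/P of the tables is intact for each pair of pointer vectors;
    -- multiplying by P clears the denominator.
    ∑-inputs-ok : ∑-inputs (λ x y z → 𝟙 (ok x y z)) * + P ≡ + (R ℕ.* (R ℕ.* Z))
    ∑-inputs-ok = begin
      ∑-inputs (λ x y z → 𝟙 (ok x y z)) * + P
        ≡⟨ cong (_* + P) (trans (∑-cartesianProductWith _,_ xs zs _)
                                (∑-cong xs (λ y → ∑-swap zs xs (λ z x → 𝟙 (ok x y z))))) ⟩
      ∑ xs (λ y → ∑ xs (λ x → ∑ zs (λ z → 𝟙 (ok x y z)))) * + P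
        ≡⟨ sym (∑-*ʳ xs (+ P) _) ⟩
      ∑ xs (λ y → ∑ xs (λ x → ∑ zs (λ z → 𝟙 (ok x y z))) * + P)
        ≡⟨ ∑-cong xs (λ y → trans (sym (∑-*ʳ xs (+ P) _)) (∑-cong xs (λ x → ∑-ok x y))) ⟩
      ∑ xs (λ y → ∑ xs (λ x → + Z))
        ≡⟨ trans (∑-cong xs (λ y → trans (∑-const xs (+ Z)) (sym (ℤₚ.pos-* R Z)))) (∑-const xs _) ⟩
      + R * + (R ℕ.* Z)
        ≡⟨ sym (ℤₚ.pos-* R _) ⟩
      + (R ℕ.* (R ℕ.* Z)) ∎
      where open ≡-Reasoning

    module _ (ks : List (Step (Ptrs m) (Ptrs m) (Tables m) S)) (st : S)
      (solves : ∀ x y z → out (exec ks st x y z) ≡ ok x y z) where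

      T : ℕ
      T = length states ℕ.^ length ks

      -- The accepted inputs are exactly the intact ones, so `cover`, started from the trivial
      -- cylinder, bounds their number by T · M.
      #ok≤ : R ℕ.* (R ℕ.* Z) ℕ.≤ (T ℕ.* M) ℕ.* P
      #ok≤ = drop‿+≤+ (begin
        + (R ℕ.* (R ℕ.* Z))                             ≡⟨ sym ∑-inputs-ok ⟩
        ∑-inputs (λ x y z → 𝟙 (ok x y z)) * + P         ≡⟨ cong (_* + P) (∑-inputs-cong (λ x y z → cong 𝟙 (sym (solves x y z)))) ⟩
        ∑-inputs (λ x y z → 𝟙 (out (exec ks st x y z))) * + P
          ≤⟨ ℤₚ.*-monoʳ-≤-nonNeg (+ P) (cover M size≤M ks st (λ _ _ → true) (λ _ _ → true) (λ _ _ → true)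
               (λ x y z e → trans (sym (solves x y z)) e)) ⟩
        + (T ℕ.* M) * + P                               ≡⟨ sym (ℤₚ.pos-* (T ℕ.* M) P) ⟩
        + ((T ℕ.* M) ℕ.* P)                             ∎)
        where open ℤₚ.≤-Reasoning

      -- After raising `#ok≤` to the fourth power, M enters only through M⁴ ≤ b. The inequality
      -- reads R⁸Z⁴ ≤ T⁴P⁴ · R⁷Z⁴P, and K = R⁷Z⁴ cancels.
      pointers≤ : r ℕ.^ m ℕ.≤ (fourth T ℕ.* fourth P) ℕ.* P
      pointers≤ = subst (ℕ._≤ (fourth T ℕ.* fourth P) ℕ.* P) R≡ (ℕₚ.*-cancelʳ-≤ R ((fourth T ℕ.* fourth P) ℕ.* P) K (begin
        R ℕ.* K                                         ≡⟨ factorˡ R Z ⟩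
        fourth (R ℕ.* (R ℕ.* Z))                        ≤⟨ fourth-mono-≤ #ok≤ ⟩
        fourth ((T ℕ.* M) ℕ.* P)                        ≡⟨ fourth-* T M P ⟩
        (fourth T ℕ.* fourth P) ℕ.* fourth M            ≤⟨ ℕₚ.*-monoʳ-≤ (fourth T ℕ.* fourth P) (proj₁ (proj₂ (fourth-root b))) ⟩
        (fourth T ℕ.* fourth P) ℕ.* b                   ≡⟨ factorʳ (fourth T ℕ.* fourth P) P R Z ⟩
        ((fourth T ℕ.* fourth P) ℕ.* P) ℕ.* K           ∎))
        where
        open ℕₚ.≤-Reasoning
        K : ℕ
        K = (R ℕ.* R ℕ.* R) ℕ.* fourth (R ℕ.* Z)
        instance
          K≢0 : NonZero K
          K≢0 = ℕₚ.m*n≢0 (R ℕ.* R ℕ.* R) (fourth (R ℕ.* Z))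
            {{ℕₚ.m*n≢0 (R ℕ.* R) R {{ℕₚ.m*n≢0 R R}}}}
            {{ℕₚ.m*n≢0 _ _ {{RZ²}} {{RZ²}}}}
            where
            RZ² : NonZero ((R ℕ.* Z) ℕ.* (R ℕ.* Z))
            RZ² = ℕₚ.m*n≢0 (R ℕ.* Z) (R ℕ.* Z) {{ℕₚ.m*n≢0 R Z}} {{ℕₚ.m*n≢0 R Z}}
        factorˡ : ∀ a c → a ℕ.* ((a ℕ.* a ℕ.* a) ℕ.* (((a ℕ.* c) ℕ.* (a ℕ.* c)) ℕ.* ((a ℕ.* c) ℕ.* (a ℕ.* c))))
          ≡ ((a ℕ.* (a ℕ.* c)) ℕ.* (a ℕ.* (a ℕ.* c))) ℕ.* ((a ℕ.* (a ℕ.* c)) ℕ.* (a ℕ.* (a ℕ.* c)))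
        factorˡ = ℕRing.solve-∀
        fourth-* : ∀ t m p → (((t ℕ.* m) ℕ.* p) ℕ.* ((t ℕ.* m) ℕ.* p)) ℕ.* (((t ℕ.* m) ℕ.* p) ℕ.* ((t ℕ.* m) ℕ.* p))
          ≡ (((t ℕ.* t) ℕ.* (t ℕ.* t)) ℕ.* ((p ℕ.* p) ℕ.* (p ℕ.* p))) ℕ.* ((m ℕ.* m) ℕ.* (m ℕ.* m))
        fourth-* = ℕRing.solve-∀
        factorʳ : ∀ e p a c → e ℕ.* (((a ℕ.* c) ℕ.* (a ℕ.* c)) ℕ.* ((a ℕ.* (a ℕ.* c)) ℕ.* (a ℕ.* (a ℕ.* (c ℕ.* (p ℕ.* a))))))
          ≡ (e ℕ.* p) ℕ.* ((a ℕ.* a ℕ.* a) ℕ.* (((a ℕ.* c) ℕ.* (a ℕ.* c)) ℕ.* ((a ℕ.* c) ℕ.* (a ℕ.* c))))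
        factorʳ = ℕRing.solve-∀

-- Positions of end points on the line.

open Counting using
  (vecs; length-vecs; bools; ∈-vecs; ∈-bools; fourth; Step; stepA; stepB; stepC; apply; exec; module Pointers; module LowerBound)
open import Data.Nat using (_≤_; _*_)

-- Offset 10 of a gadget is written as offset 0 of the next one; this is the point through which
-- neighbouring gadgets are linked.
pos : ℕ → Fin 10 → ℕ
pos g u = toℕ u ℕ.+ 10 ℕ.* g

pos-monoʳ : ∀ g {u v : Fin 10} → toℕ u ℕ.≤ toℕ v → pos g u ℕ.≤ pos g v
pos-monoʳ g = ℕₚ.+-monoˡ-≤ (10 ℕ.* g)

pos-monoˡ : ∀ {g h} → g ℕ.≤ h → ∀ v → pos g zero ℕ.≤ pos h v
pos-monoˡ {g} {h} g≤h v = ℕₚ.≤-trans (ℕₚ.*-monoʳ-≤ 10 g≤h) (ℕₚ.m≤n+m _ (toℕ v))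

pos-<-suc : ∀ g u → pos g u ℕ.< pos (suc g) zero
pos-<-suc g u = subst (pos g u ℕ.<_) (sym (ℕₚ.*-suc 10 g)) (ℕₚ.+-monoˡ-< (10 ℕ.* g) (Finₚ.toℕ<n u))

pos-< : ∀ {g h} → g ℕ.< h → ∀ u v → pos g u ℕ.< pos h v
pos-< {g} g<h u v = ℕₚ.<-≤-trans (pos-<-suc g u) (pos-monoˡ g<h v)

≤⇒≤ᵇ≡true : ∀ {m n} → m ℕ.≤ n → (m ≤ᵇ n) ≡ true
≤⇒≤ᵇ≡true m≤n = Equivalence.to Boolₚ.T-≡ (ℕₚ.≤⇒≤ᵇ m≤n)

>⇒≤ᵇ≡false : ∀ {m n} → n ℕ.< m → (m ≤ᵇ n) ≡ false
>⇒≤ᵇ≡false {m} {n} n<m = Boolₚ.¬-not (λ e → ℕₚ.<⇒≱ n<m (ℕₚ.≤ᵇ⇒≤ m n (Equivalence.from Boolₚ.T-≡ e)))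

≤ᵇ-+ʳ : ∀ u v k → (u ℕ.+ k ≤ᵇ v ℕ.+ k) ≡ (u ≤ᵇ v)
≤ᵇ-+ʳ u v k with u ℕ.≤? v
... | yes u≤v = trans (≤⇒≤ᵇ≡true (ℕₚ.+-monoˡ-≤ k u≤v)) (sym (≤⇒≤ᵇ≡true u≤v))
... | no  u≰v = trans (>⇒≤ᵇ≡false (ℕₚ.+-monoˡ-< k (ℕₚ.≰⇒> u≰v))) (sym (>⇒≤ᵇ≡false (ℕₚ.≰⇒> u≰v)))

-- Between different gadgets the comparison is decided by the gadget numbers. Hence the independence
-- of a row from some bits becomes a finite check of offsets within one gadget.
pos-≤ᵇ-cong : ∀ g h (u v u′ v′ : Fin 10) → (g ≡ h → (toℕ u ≤ᵇ toℕ v) ≡ (toℕ u′ ≤ᵇ toℕ v′)) →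
  (pos g u ≤ᵇ pos h v) ≡ (pos g u′ ≤ᵇ pos h v′)
pos-≤ᵇ-cong g h u v u′ v′ e with ℕₚ.<-cmp g h
... | tri< g<h _ _ = trans (≤⇒≤ᵇ≡true (ℕₚ.<⇒≤ (pos-< g<h u v))) (sym (≤⇒≤ᵇ≡true (ℕₚ.<⇒≤ (pos-< g<h u′ v′))))
... | tri> _ _ h<g = trans (>⇒≤ᵇ≡false (pos-< h<g v u)) (sym (>⇒≤ᵇ≡false (pos-< h<g v′ u′)))
... | tri≈ _ refl _ = trans (≤ᵇ-+ʳ (toℕ u) (toℕ v) _) (trans (e refl) (sym (≤ᵇ-+ʳ (toℕ u′) (toℕ v′) _)))

-- Interval graphs with natural end points, and walks in them.

ℕ⇒ℚ : ℕ → ℚ.ℚ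
ℕ⇒ℚ n = ℚ.mkℚ (+ n) 0 (Coprime.sym (Coprime.1-coprimeTo n))

ℕ⇒ℚ-mono : ∀ {m n} → m ℕ.≤ n → ℕ⇒ℚ m ℚ.≤ ℕ⇒ℚ n
ℕ⇒ℚ-mono {m} {n} m≤n = ℚ.*≤* (subst₂ (λ a b → a ℤ.≤ b)
  (sym (ℤₚ.*-identityʳ (+ m))) (sym (ℤₚ.*-identityʳ (+ n))) (+≤+ m≤n))

ℕ⇒ℚ-cancel : ∀ {m n} → ℕ⇒ℚ m ℚ.≤ ℕ⇒ℚ n → m ℕ.≤ n
ℕ⇒ℚ-cancel {m} {n} (ℚ.*≤* le) = drop‿+≤+ (subst₂ (λ a b → a ℤ.≤ b)
  (ℤₚ.*-identityʳ (+ m)) (ℤₚ.*-identityʳ (+ n)) le)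

Reach-trans : ∀ {n} {G : Graph n} {u v w} → Reach G u v → Reach G v w → Reach G u w
Reach-trans here       q = q
Reach-trans (step e p) q = step e (Reach-trans p q)

Reach-sym : ∀ {n} {G : Graph n} {u v} → Reach G u v → Reach G v u
Reach-sym here = here
Reach-sym {G = G} (step {u} {v} e p) = Reach-trans (Reach-sym p) (step (trans (Graph.sym G v u) e) here)

module IntervalGraph {n : ℕ} (lo′ hi′ : Fin n → ℕ) (lo≤hi′ : ∀ i → lo′ i ℕ.≤ hi′ i) where

  edge : Fin n → Fin n → Bool
  edge i j = not (does (i ≟ j)) ∧ ((lo′ i ≤ᵇ hi′ j) ∧ (lo′ j ≤ᵇ hi′ i))

  edge-irrefl : ∀ i → edge i i ≡ false
  edge-irrefl i rewrite dec-true (i ≟ i) refl = refl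

  edge-sym : ∀ i j → edge i j ≡ edge j i
  edge-sym i j with i ≟ j | j ≟ i
  ... | yes _    | yes _   = refl
  ... | yes refl | no  j≢i = contradiction refl j≢i
  ... | no  i≢j  | yes refl = contradiction refl i≢j
  ... | no  _    | no  _   = Boolₚ.∧-comm (lo′ i ≤ᵇ hi′ j) (lo′ j ≤ᵇ hi′ i)

  -- The adjacency is stored in a vector, so that the stream items of two graphs with
  -- pointwise equal rows are propositionally equal without function extensionality.
  graph : Graph n
  graph .adj i j = lookup (tabulate (edge i)) j
  graph .Graph.sym i j = trans (Vecₚ.lookup∘tabulate (edge i) j)
    (trans (edge-sym i j) (sym (Vecₚ.lookup∘tabulate (edge j) i)))
  graph .irrfl i = trans (Vecₚ.lookup∘tabulate (edge i) i) (edge-irrefl i)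

  edge⇒meet : ∀ {i j} → edge i j ≡ true → lo′ i ℕ.≤ hi′ j × lo′ j ℕ.≤ hi′ i
  edge⇒meet {i} {j} e with does (i ≟ j) | lo′ i ≤ᵇ hi′ j in p | lo′ j ≤ᵇ hi′ i in q
  ... | false | true | true = ℕₚ.≤ᵇ⇒≤ _ _ (Equivalence.from Boolₚ.T-≡ p) , ℕₚ.≤ᵇ⇒≤ _ _ (Equivalence.from Boolₚ.T-≡ q)

  meet⇒edge : ∀ {i j} → i ≢ j → lo′ i ℕ.≤ hi′ j → lo′ j ℕ.≤ hi′ i → edge i j ≡ true
  meet⇒edge {i} {j} i≢j p q rewrite dec-false (i ≟ j) i≢j | ≤⇒≤ᵇ≡true p | ≤⇒≤ᵇ≡true q = refl

  adj⇒meet : ∀ {i j} → adj graph i j ≡ true → lo′ i ℕ.≤ hi′ j × lo′ j ℕ.≤ hi′ i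
  adj⇒meet {i} {j} e = edge⇒meet (trans (sym (Vecₚ.lookup∘tabulate (edge i) j)) e)

  meet⇒adj : ∀ {i j} → i ≢ j → lo′ i ℕ.≤ hi′ j → lo′ j ℕ.≤ hi′ i → adj graph i j ≡ true
  meet⇒adj {i} {j} i≢j p q = trans (Vecₚ.lookup∘tabulate (edge i) j) (meet⇒edge i≢j p q)

  isInterval : IsIntervalGraph graph
  isInterval = (λ i → [ ℕ⇒ℚ (lo′ i) , ℕ⇒ℚ (hi′ i) ]⟨ ℕ⇒ℚ-mono (lo≤hi′ i) ⟩) , λ i j i≢j → mk⇔
    (λ e → ℕ⇒ℚ-mono (proj₁ (adj⇒meet {i} {j} e)) , ℕ⇒ℚ-mono (proj₂ (adj⇒meet {i} {j} e)))
    (λ (p , q) → meet⇒adj i≢j (ℕ⇒ℚ-cancel p) (ℕ⇒ℚ-cancel q))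

  touch : ∀ {i j} → lo′ i ℕ.≤ hi′ j → lo′ j ℕ.≤ hi′ i → Reach graph i j
  touch {i} {j} p q with i ≟ j
  ... | yes refl = here
  ... | no  i≢j  = step (meet⇒adj i≢j p q) here

  _∋_ : Fin n → ℕ → Set
  i ∋ t = lo′ i ℕ.≤ t × t ℕ.≤ hi′ i

  common-point : ∀ {i j t} → i ∋ t → j ∋ t → Reach graph i j
  common-point (p , q) (p′ , q′) = touch (ℕₚ.≤-trans p q′) (ℕₚ.≤-trans p′ q)

  -- A walk starting left of the gap stays there: an edge from an interval ending by s to one
  -- starting at t or later would force t ≤ s.
  gap⇒¬Reach : ∀ s t → s ℕ.< t → (∀ i → hi′ i ℕ.≤ s ⊎ t ℕ.≤ lo′ i) →
    ∀ {i j} → hi′ i ℕ.≤ s → t ℕ.≤ lo′ j → ¬ Reach graph i j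
  gap⇒¬Reach s t s<t sides {i} i≤s t≤j here = ℕₚ.<⇒≱ s<t (ℕₚ.≤-trans t≤j (ℕₚ.≤-trans (lo≤hi′ i) i≤s))
  gap⇒¬Reach s t s<t sides {i} i≤s t≤j (step {v = v} e p) with sides v
  ... | inj₁ v≤s = gap⇒¬Reach s t s<t sides v≤s t≤j p
  ... | inj₂ t≤v = ℕₚ.<⇒≱ s<t (ℕₚ.≤-trans t≤v (ℕₚ.≤-trans (proj₂ (adj⇒meet {i} {v} e)) i≤s))

-- The gadgets and what each row of the adjacency matrix depends on.

data Vertex (K : ℕ) : Set where
  a b b′ c : Fin K → Vertex K
  -- All pads sit at the point 0, the left end of the chain. They bring the number of vertices to
  -- the prescribed n, and one of them serves as origin.
  pad      : Vertex K

-- Against c, which starts at 7, only y matters; against b′, which starts at 5 or 9, only z matters.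
hiA : Bool → Bool → Fin 10
hiA y z = if y then # 8 else if z then # 6 else # 3

hiB : Bool → Fin 10
hiB x = if x then # 8 else # 3

loB′ : Bool → Fin 10
loB′ z = if z then # 5 else # 9

module Gadgets (K : ℕ) where

  module Ends (x y z : Fin K → Bool) where

    left right : Vertex K → ℕ
    left (a g)  = pos (toℕ g) zero
    left (b g)  = pos (toℕ g) zero
    left (b′ g) = pos (toℕ g) (loB′ (z g))
    left (c g)  = pos (toℕ g) (# 7)
    left pad    = pos 0 zero
    right (a g)  = pos (toℕ g) (hiA (y g) (z g))
    right (b g)  = pos (toℕ g) (hiB (x g))
    right (b′ g) = pos (suc (toℕ g)) zero
    right (c g)  = pos (suc (toℕ g)) zero
    right pad    = pos 0 zero

    left≤right : ∀ v → left v ℕ.≤ right v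
    left≤right (a g)  = pos-monoʳ (toℕ g) {zero} {hiA (y g) (z g)} z≤n
    left≤right (b g)  = pos-monoʳ (toℕ g) {zero} {hiB (x g)} z≤n
    left≤right (b′ g) = ℕₚ.<⇒≤ (pos-<-suc (toℕ g) (loB′ (z g)))
    left≤right (c g)  = ℕₚ.<⇒≤ (pos-<-suc (toℕ g) (# 7))
    left≤right pad    = z≤n

    meets : Vertex K → Vertex K → Bool
    meets u v = (left u ≤ᵇ right v) ∧ (left v ≤ᵇ right u)

  open Ends using (meets)

  -- The bits x enter only through the right ends of the b's. Since a starts at offset 0, no right
  -- end in its own gadget lies below that start. The same reasoning, with y and the right ends of
  -- the a's, gives `meets-b`.
  meets-a : ∀ x x′ y z g v → meets x y z (a g) v ≡ meets x′ y z (a g) v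
  meets-a x x′ y z g (b h)  = cong₂ _∧_ (pos-≤ᵇ-cong (toℕ g) (toℕ h) zero (hiB (x h)) zero (hiB (x′ h)) (λ _ → refl)) refl
  meets-a x x′ y z g (a h)  = refl
  meets-a x x′ y z g (b′ h) = refl
  meets-a x x′ y z g (c h)  = refl
  meets-a x x′ y z g pad    = refl

  meets-b : ∀ x y y′ z g v → meets x y z (b g) v ≡ meets x y′ z (b g) v
  meets-b x y y′ z g (a h)  = cong₂ _∧_
    (pos-≤ᵇ-cong (toℕ g) (toℕ h) zero (hiA (y h) (z h)) zero (hiA (y′ h) (z h)) (λ _ → refl)) refl
  meets-b x y y′ z g (b h)  = refl
  meets-b x y y′ z g (b′ h) = refl
  meets-b x y y′ z g (c h)  = refl
  meets-b x y y′ z g pad    = refl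

  meets-b′ : ∀ x y y′ z g v → meets x y z (b′ g) v ≡ meets x y′ z (b′ g) v
  meets-b′ x y y′ z g (a h)  = cong₂ _∧_
    (pos-≤ᵇ-cong (toℕ g) (toℕ h) (loB′ (z g)) (hiA (y h) (z h)) (loB′ (z g)) (hiA (y′ h) (z h))
      -- The bit z is taken at g and the bits of a at h; once g = h is known, `same` compares them
      -- inside one gadget.
      (λ e → subst (λ k → (toℕ (loB′ (z g)) ≤ᵇ toℕ (hiA (y k) (z k))) ≡ (toℕ (loB′ (z g)) ≤ᵇ toℕ (hiA (y′ k) (z k))))
                   (Finₚ.toℕ-injective e) (same (y g) (y′ g) (z g)))) refl
    where
    same : ∀ y y′ z → (toℕ (loB′ z) ≤ᵇ toℕ (hiA y z)) ≡ (toℕ (loB′ z) ≤ᵇ toℕ (hiA y′ z))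
    same true  true  z     = refl
    same false false z     = refl
    same true  false true  = refl
    same true  false false = refl
    same false true  true  = refl
    same false true  false = refl
  meets-b′ x y y′ z g (b h)  = refl
  meets-b′ x y y′ z g (b′ h) = refl
  meets-b′ x y y′ z g (c h)  = refl
  meets-b′ x y y′ z g pad    = refl

  -- For comparing the start of b′ with the right end of c in the preceding gadget, or with a pad:
  -- both possible starts, 5 and 9, lie beyond offset 0.
  loB′≰0 : ∀ z z′ → (toℕ (loB′ z) ≤ᵇ 0) ≡ (toℕ (loB′ z′) ≤ᵇ 0)
  loB′≰0 true  true  = refl
  loB′≰0 true  false = refl
  loB′≰0 false true  = refl
  loB′≰0 false false = refl

  meets-c : ∀ x y z z′ g v → meets x y z (c g) v ≡ meets x y z′ (c g) v
  meets-c x y z z′ g (a h)  = cong₂ _∧_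
    (pos-≤ᵇ-cong (toℕ g) (toℕ h) (# 7) (hiA (y h) (z h)) (# 7) (hiA (y h) (z′ h)) (λ _ → same (y h) (z h) (z′ h))) refl
    where
    same : ∀ y z z′ → (7 ≤ᵇ toℕ (hiA y z)) ≡ (7 ≤ᵇ toℕ (hiA y z′))
    same true  z     z′    = refl
    same false true  true  = refl
    same false true  false = refl
    same false false true  = refl
    same false false false = refl
  meets-c x y z z′ g (b h)  = refl
  meets-c x y z z′ g (b′ h) = cong₂ _∧_ refl
    (pos-≤ᵇ-cong (toℕ h) (suc (toℕ g)) (loB′ (z h)) zero (loB′ (z′ h)) zero (λ _ → loB′≰0 (z h) (z′ h)))
  meets-c x y z z′ g (c h)  = refl
  meets-c x y z z′ g pad    = refl

  meets-pad : ∀ x y z z′ v → meets x y z pad v ≡ meets x y z′ pad v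
  meets-pad x y z z′ (a h)  = refl
  meets-pad x y z z′ (b h)  = refl
  meets-pad x y z z′ (b′ h) = cong₂ _∧_ refl
    (pos-≤ᵇ-cong (toℕ h) 0 (loB′ (z h)) zero (loB′ (z′ h)) zero (λ _ → loB′≰0 (z h) (z′ h)))
  meets-pad x y z z′ (c h)  = refl
  meets-pad x y z z′ pad    = refl

  -- Connectivity of the chain of gadgets.

  module Chain {n : ℕ} (vertex : Fin n → Vertex K) (index-a index-b index-b′ index-c : Fin K → Fin n)
    (vertex-a : ∀ g → vertex (index-a g) ≡ a g) (vertex-b : ∀ g → vertex (index-b g) ≡ b g)
    (vertex-b′ : ∀ g → vertex (index-b′ g) ≡ b′ g) (vertex-c : ∀ g → vertex (index-c g) ≡ c g)
    (x y z : Fin K → Bool) where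

    open Ends x y z
    open IntervalGraph (left ∘ vertex) (right ∘ vertex) (left≤right ∘ vertex) public

    ∋-vertex : ∀ {i v t} → vertex i ≡ v → left v ℕ.≤ t → t ℕ.≤ right v → i ∋ t
    ∋-vertex refl p q = p , q

    touch-vertex : ∀ {i j u v} → vertex i ≡ u → vertex j ≡ v → left u ℕ.≤ right v → left v ℕ.≤ right u → Reach graph i j
    touch-vertex refl refl = touch

    a∋ : ∀ g → index-a g ∋ pos (toℕ g) zero
    a∋ g = ∋-vertex (vertex-a g) ℕₚ.≤-refl (left≤right (a g))

    b∋ : ∀ g → index-b g ∋ pos (toℕ g) zero
    b∋ g = ∋-vertex (vertex-b g) ℕₚ.≤-refl (left≤right (b g))

    b′∋ : ∀ g → index-b′ g ∋ pos (suc (toℕ g)) zero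
    b′∋ g = ∋-vertex (vertex-b′ g) (left≤right (b′ g)) ℕₚ.≤-refl

    c∋ : ∀ g → index-c g ∋ pos (suc (toℕ g)) zero
    c∋ g = ∋-vertex (vertex-c g) (left≤right (c g)) ℕₚ.≤-refl

    -- A single edge crosses the gadget: b to c if x is set, a to c if y is, a to b′ if only z is.
    bridge : ∀ g → x g ∨ (y g ∨ z g) ≡ true →
      ∃ λ i → ∃ λ j → i ∋ pos (toℕ g) zero × j ∋ pos (suc (toℕ g)) zero × Reach graph i j
    bridge g e with x g in ex | y g in ey | z g in ez
    ... | true | _ | _ = index-b g , index-c g , b∋ g , c∋ g ,
      touch-vertex (vertex-b g) (vertex-c g) (pos-monoˡ (ℕₚ.n≤1+n _) zero)
        (subst (λ t → pos (toℕ g) (# 7) ℕ.≤ pos (toℕ g) (hiB t)) (sym ex) (pos-monoʳ (toℕ g) {# 7} {# 8} (ℕₚ.n≤1+n 7)))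
    ... | false | true | _ = index-a g , index-c g , a∋ g , c∋ g ,
      touch-vertex (vertex-a g) (vertex-c g) (pos-monoˡ (ℕₚ.n≤1+n _) zero)
        (subst (λ t → pos (toℕ g) (# 7) ℕ.≤ pos (toℕ g) (hiA t (z g))) (sym ey) (pos-monoʳ (toℕ g) {# 7} {# 8} (ℕₚ.n≤1+n 7)))
    ... | false | false | true = index-a g , index-b′ g , a∋ g , b′∋ g ,
      touch-vertex (vertex-a g) (vertex-b′ g) (pos-monoˡ (ℕₚ.n≤1+n _) zero)
        (subst₂ (λ s t → pos (toℕ g) (loB′ t) ℕ.≤ pos (toℕ g) (hiA s t)) (sym ey) (sym ez)
          (pos-monoʳ (toℕ g) {# 5} {# 6} (ℕₚ.n≤1+n 5)))

    module _ (all-bridged : ∀ g → x g ∨ (y g ∨ z g) ≡ true) where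

      -- Induction leftwards along the linking points: the bridge of gadget t leads from the point
      -- at its right end to the one at its left end.
      reach-origin : ∀ {i o} t → t ℕ.≤ K → i ∋ pos t zero → o ∋ pos 0 zero → Reach graph i o
      reach-origin zero    _   i∋ o∋ = common-point i∋ o∋
      reach-origin {i} (suc t) t<K i∋ o∋ =
        let j , k , j∋ , k∋ , p = bridge (fromℕ< t<K) (all-bridged (fromℕ< t<K)) in
        Reach-trans (common-point i∋ (subst (λ t → k ∋ pos (suc t) zero) (Finₚ.toℕ-fromℕ< t<K) k∋))
        (Reach-trans (Reach-sym p)
        (reach-origin t (ℕₚ.<⇒≤ t<K) (subst (λ t → j ∋ pos t zero) (Finₚ.toℕ-fromℕ< t<K) j∋) o∋))

      -- For a and b take the left end of the gadget, for b′ and c the right end, for pads the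
      -- origin.
      landmark : ∀ {i} v → vertex i ≡ v → ∃ λ t → t ℕ.≤ K × i ∋ pos t zero
      landmark (a g)  e = toℕ g , Finₚ.toℕ≤n g , ∋-vertex e ℕₚ.≤-refl (left≤right (a g))
      landmark (b g)  e = toℕ g , Finₚ.toℕ≤n g , ∋-vertex e ℕₚ.≤-refl (left≤right (b g))
      landmark (b′ g) e = suc (toℕ g) , Finₚ.toℕ<n g , ∋-vertex e (left≤right (b′ g)) ℕₚ.≤-refl
      landmark (c g)  e = suc (toℕ g) , Finₚ.toℕ<n g , ∋-vertex e (left≤right (c g)) ℕₚ.≤-refl
      landmark pad    e = 0 , z≤n , ∋-vertex e ℕₚ.≤-refl ℕₚ.≤-refl

      connected : ∀ o → o ∋ pos 0 zero → Connected graph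
      connected o o∋ u v =
        let t , t≤K , u∋ = landmark (vertex u) refl
            s , s≤K , v∋ = landmark (vertex v) refl
        in Reach-trans (reach-origin t t≤K u∋ o∋) (Reach-sym (reach-origin s s≤K v∋ o∋))

    -- In the broken gadget a and b end at 3, while c starts at 7 and b′ at 9. No interval enters
    -- the gap between 3 and 7, which separates a from c.
    disconnected : ∀ g → x g ∨ (y g ∨ z g) ≡ false → ¬ Connected graph
    disconnected g e conn with x g in ex | y g in ey | z g in ez
    ... | false | false | false = gap⇒¬Reach (pos (toℕ g) (# 3)) (pos (toℕ g) (# 7))
        (ℕₚ.+-monoˡ-< (10 ℕ.* toℕ g) (ℕₚ.m≤m+n 4 3)) (sides ∘ vertex)
        (subst (λ v → right v ℕ.≤ _) (sym (vertex-a g)) a≤)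
        (subst (λ v → _ ℕ.≤ left v) (sym (vertex-c g)) ℕₚ.≤-refl)
        (conn (index-a g) (index-c g))
      where
      a≤ : right (a g) ℕ.≤ pos (toℕ g) (# 3)
      a≤ = subst₂ (λ s t → pos (toℕ g) (hiA s t) ℕ.≤ pos (toℕ g) (# 3)) (sym ey) (sym ez) ℕₚ.≤-refl
      b≤ : right (b g) ℕ.≤ pos (toℕ g) (# 3)
      b≤ = subst (λ s → pos (toℕ g) (hiB s) ℕ.≤ pos (toℕ g) (# 3)) (sym ex) ℕₚ.≤-refl
      ≤b′ : pos (toℕ g) (# 7) ℕ.≤ left (b′ g)
      ≤b′ = subst (λ s → pos (toℕ g) (# 7) ℕ.≤ pos (toℕ g) (loB′ s)) (sym ez) (pos-monoʳ (toℕ g) {# 7} {# 9} (ℕₚ.m≤m+n 7 2))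
      sides : ∀ v → right v ℕ.≤ pos (toℕ g) (# 3) ⊎ pos (toℕ g) (# 7) ℕ.≤ left v
      sides pad = inj₁ (pos-monoˡ {0} {toℕ g} z≤n (# 3))
      sides (a h) with Finₚ.<-cmp h g
      ... | tri< h<g _ _  = inj₁ (ℕₚ.<⇒≤ (pos-< h<g (hiA (y h) (z h)) (# 3)))
      ... | tri≈ _ refl _ = inj₁ a≤
      ... | tri> _ _ g<h  = inj₂ (ℕₚ.<⇒≤ (pos-< g<h (# 7) zero))
      sides (b h) with Finₚ.<-cmp h g
      ... | tri< h<g _ _  = inj₁ (ℕₚ.<⇒≤ (pos-< h<g (hiB (x h)) (# 3)))
      ... | tri≈ _ refl _ = inj₁ b≤
      ... | tri> _ _ g<h  = inj₂ (ℕₚ.<⇒≤ (pos-< g<h (# 7) zero))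
      sides (b′ h) with Finₚ.<-cmp h g
      ... | tri< h<g _ _  = inj₁ (pos-monoˡ h<g (# 3))
      ... | tri≈ _ refl _ = inj₂ ≤b′
      ... | tri> _ _ g<h  = inj₂ (ℕₚ.<⇒≤ (pos-< g<h (# 7) (loB′ (z h))))
      sides (c h) with Finₚ.<-cmp h g
      ... | tri< h<g _ _  = inj₁ (pos-monoˡ h<g (# 3))
      ... | tri≈ _ refl _ = inj₂ ℕₚ.≤-refl
      ... | tri> _ _ g<h  = inj₂ (ℕₚ.<⇒≤ (pos-< g<h (# 7) (# 7)))

-- From streaming algorithms to number-on-forehead protocols.

allFin-+ : ∀ k l → allFin (k ℕ.+ l) ≡ map (_↑ˡ l) (allFin k) ++ map (k ↑ʳ_) (allFin l)
allFin-+ k l = trans (tabulate-+ k id)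
  (cong₂ _++_ (sym (Listₚ.map-tabulate id (_↑ˡ l))) (sym (Listₚ.map-tabulate id (k ↑ʳ_))))
  where
  tabulate-+ : ∀ {A : Set} k (f : Fin (k ℕ.+ l) → A) →
    tabulateˡ f ≡ tabulateˡ (f ∘ (_↑ˡ l)) ++ tabulateˡ (f ∘ (k ↑ʳ_))
  tabulate-+ zero    f = refl
  tabulate-+ (suc k) f = cong (f zero ∷_) (tabulate-+ k (f ∘ suc))

module Reduction (r : ℕ) .{{_ : NonZero r}} (x₀ : Fin r) (m e : ℕ) where

  open Pointers r

  -- One gadget per cell of each block. The summands of n follow the arrival order: all a, then all
  -- b and b′, then all c with the e + 1 pads, so that one pass is one step of each player.
  K n : ℕ
  K = m ℕ.* (r ℕ.* r)
  n = K ℕ.+ ((K ℕ.+ K) ℕ.+ (K ℕ.+ suc e))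

  open Gadgets K

  inA : Fin K → Fin n
  inA j = j ↑ˡ _

  inB : Fin (K ℕ.+ K) → Fin n
  inB j = K ↑ʳ (j ↑ˡ _)

  inC : Fin (K ℕ.+ suc e) → Fin n
  inC j = K ↑ʳ ((K ℕ.+ K) ↑ʳ j)

  vertexB : Fin (K ℕ.+ K) → Vertex K
  vertexB j = [ b , b′ ]′ (splitAt K j)

  vertexC : Fin (K ℕ.+ suc e) → Vertex K
  vertexC j = [ c , const pad ]′ (splitAt K j)

  vertex : Fin n → Vertex K
  vertex i = [ a , (λ j → [ vertexB , vertexC ]′ (splitAt (K ℕ.+ K) j)) ]′ (splitAt K i)

  vertex-inA : ∀ j → vertex (inA j) ≡ a j
  vertex-inA j rewrite Finₚ.splitAt-↑ˡ K j ((K ℕ.+ K) ℕ.+ (K ℕ.+ suc e)) = refl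

  vertex-inB : ∀ j → vertex (inB j) ≡ vertexB j
  vertex-inB j rewrite Finₚ.splitAt-↑ʳ K ((K ℕ.+ K) ℕ.+ (K ℕ.+ suc e)) (j ↑ˡ (K ℕ.+ suc e))
                     | Finₚ.splitAt-↑ˡ (K ℕ.+ K) j (K ℕ.+ suc e) = refl

  vertex-inC : ∀ j → vertex (inC j) ≡ vertexC j
  vertex-inC j rewrite Finₚ.splitAt-↑ʳ K ((K ℕ.+ K) ℕ.+ (K ℕ.+ suc e)) ((K ℕ.+ K) ↑ʳ j)
                     | Finₚ.splitAt-↑ʳ (K ℕ.+ K) (K ℕ.+ suc e) j = refl

  Coords : Set
  Coords = Fin m × Fin r × Fin r

  coords : Fin K → Coords
  coords g = let i , st = remQuot (r ℕ.* r) g in i , remQuot r st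

  coords-combine : ∀ i s t → coords (combine i (combine s t)) ≡ (i , s , t)
  coords-combine i s t = trans
    (cong (λ (i , st) → i , remQuot {r} r st) (Finₚ.remQuot-combine i (combine s t)))
    (cong (i ,_) (Finₚ.remQuot-combine s t))

  -- The bits are negated because a gadget breaks when all three of its bits are 0.
  xbit ybit : Ptrs m → Coords → Bool
  xbit xs (i , s , t) = not (does (lookup xs i ≟ s))
  ybit ys (i , s , t) = not (does (lookup ys i ≟ t))

  zbit : Tables m → Coords → Bool
  zbit zs (i , s , t) = not (cell s t (lookup zs i))

  -- In each block only the gadget selected by both pointers has x = y = 0, and there `ok` says that
  -- the table entry is 0, so z = 1.
  ok⇒bridged : ∀ xs ys zs → ok xs ys zs ≡ true → ∀ g → xbit xs g ∨ (ybit ys g ∨ zbit zs g) ≡ true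
  ok⇒bridged xs ys zs e (i , s , t) with lookup xs i ≟ s | lookup ys i ≟ t
  ... | no _     | _        = refl
  ... | yes _    | no _     = refl
  ... | yes refl | yes refl = at xs ys zs e i
    where
    at : ∀ {m} (xs ys : Ptrs m) zs → ok xs ys zs ≡ true →
      ∀ i → not (cell (lookup xs i) (lookup ys i) (lookup zs i)) ≡ true
    at (x ∷ xs) (y ∷ ys) (z ∷ zs) e i       with cell x y z in eq
    at (x ∷ xs) (y ∷ ys) (z ∷ zs) e zero    | false = cong not eq
    at (x ∷ xs) (y ∷ ys) (z ∷ zs) e (suc i) | false = at xs ys zs e i

  ¬ok⇒broken : ∀ xs ys zs → ok xs ys zs ≡ false → ∃ λ g → xbit xs g ∨ (ybit ys g ∨ zbit zs g) ≡ false
  ¬ok⇒broken xs ys zs e with find xs ys zs e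
    where
    find : ∀ {m} (xs ys : Ptrs m) zs → ok xs ys zs ≡ false →
      ∃ λ i → cell (lookup xs i) (lookup ys i) (lookup zs i) ≡ true
    find []       []       []       ()
    find (x ∷ xs) (y ∷ ys) (z ∷ zs) e with cell x y z in eq
    ... | true  = zero , eq
    ... | false = let i , p = find xs ys zs e in suc i , p
  ... | i , p = (i , lookup xs i , lookup ys i) , broken
    where
    broken : not (does (lookup xs i ≟ lookup xs i)) ∨
             (not (does (lookup ys i ≟ lookup ys i)) ∨ not (cell (lookup xs i) (lookup ys i) (lookup zs i))) ≡ false
    broken rewrite dec-true (lookup xs i ≟ lookup xs i) refl
                 | dec-true (lookup ys i ≟ lookup ys i) refl
                 | p = refl

  X Y : Ptrs m → Fin K → Bool
  X xs = xbit xs ∘ coords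
  Y ys = ybit ys ∘ coords

  Z : Tables m → Fin K → Bool
  Z zs = zbit zs ∘ coords

  vertex-b : ∀ g → vertex (inB (g ↑ˡ K)) ≡ b g
  vertex-b g = trans (vertex-inB (g ↑ˡ K)) (cong [ b , b′ ]′ (Finₚ.splitAt-↑ˡ K g K))

  vertex-b′ : ∀ g → vertex (inB (K ↑ʳ g)) ≡ b′ g
  vertex-b′ g = trans (vertex-inB (K ↑ʳ g)) (cong [ b , b′ ]′ (Finₚ.splitAt-↑ʳ K K g))

  vertex-c : ∀ g → vertex (inC (g ↑ˡ suc e)) ≡ c g
  vertex-c g = trans (vertex-inC (g ↑ˡ suc e)) (cong [ c , const pad ]′ (Finₚ.splitAt-↑ˡ K g (suc e)))

  vertex-pad : vertex (inC (K ↑ʳ zero)) ≡ pad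
  vertex-pad = trans (vertex-inC (K ↑ʳ zero)) (cong [ c , const pad ]′ (Finₚ.splitAt-↑ʳ K (suc e) zero))

  module G (xs ys : Ptrs m) (zs : Tables m) =
    Chain vertex inA (λ g → inB (g ↑ˡ K)) (λ g → inB (K ↑ʳ g)) (λ g → inC (g ↑ˡ suc e))
          vertex-inA vertex-b vertex-b′ vertex-c (X xs) (Y ys) (Z zs)

  σ : Ptrs m → Ptrs m → Tables m → Stream n
  σ xs ys zs = stream (G.graph xs ys zs)

  item-cong : ∀ {xs xs′ ys ys′ zs zs′} i →
    (∀ v → Ends.meets (X xs) (Y ys) (Z zs) (vertex i) v ≡ Ends.meets (X xs′) (Y ys′) (Z zs′) (vertex i) v) →
    σ xs ys zs i ≡ σ xs′ ys′ zs′ i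
  item-cong i e = cong (λ row j → lookup row (inject≤ j (Finₚ.toℕ≤n i)))
    (Vecₚ.tabulate-cong (λ j → cong (not (does (i ≟ j)) ∧_) (e (vertex j))))

  σ-inA : ∀ xs xs′ ys zs j → σ xs ys zs (inA j) ≡ σ xs′ ys zs (inA j)
  σ-inA xs xs′ ys zs j = item-cong {xs} {xs′} {ys} {ys} {zs} {zs} (inA j) same
    where
    same : ∀ v → Ends.meets (X xs) (Y ys) (Z zs) (vertex (inA j)) v ≡ Ends.meets (X xs′) (Y ys) (Z zs) (vertex (inA j)) v
    same v rewrite vertex-inA j = meets-a (X xs) (X xs′) (Y ys) (Z zs) j v

  σ-inB : ∀ xs ys ys′ zs j → σ xs ys zs (inB j) ≡ σ xs ys′ zs (inB j)
  σ-inB xs ys ys′ zs j = item-cong {xs} {xs} {ys} {ys′} {zs} {zs} (inB j) same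
    where
    same : ∀ v → Ends.meets (X xs) (Y ys) (Z zs) (vertex (inB j)) v ≡ Ends.meets (X xs) (Y ys′) (Z zs) (vertex (inB j)) v
    same v rewrite vertex-inB j with splitAt K j
    ... | inj₁ g = meets-b (X xs) (Y ys) (Y ys′) (Z zs) g v
    ... | inj₂ g = meets-b′ (X xs) (Y ys) (Y ys′) (Z zs) g v

  σ-inC : ∀ xs ys zs zs′ j → σ xs ys zs (inC j) ≡ σ xs ys zs′ (inC j)
  σ-inC xs ys zs zs′ j = item-cong {xs} {xs} {ys} {ys} {zs} {zs′} (inC j) same
    where
    same : ∀ v → Ends.meets (X xs) (Y ys) (Z zs) (vertex (inC j)) v ≡ Ends.meets (X xs) (Y ys) (Z zs′) (vertex (inC j)) v
    same v rewrite vertex-inC j with splitAt K j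
    ... | inj₁ g = meets-c (X xs) (Y ys) (Z zs) (Z zs′) g v
    ... | inj₂ _ = meets-pad (X xs) (Y ys) (Z zs) (Z zs′) v

  allFin-n : allFin n ≡ map inA (allFin K) ++ (map inB (allFin (K ℕ.+ K)) ++ map inC (allFin (K ℕ.+ suc e)))
  allFin-n = trans (allFin-+ K _) (cong (map inA (allFin K) ++_)
    (trans (cong (map (K ↑ʳ_)) (allFin-+ (K ℕ.+ K) (K ℕ.+ suc e)))
    (trans (Listₚ.map-++ (K ↑ʳ_) (map (_↑ˡ (K ℕ.+ suc e)) (allFin (K ℕ.+ K))) (map ((K ℕ.+ K) ↑ʳ_) (allFin (K ℕ.+ suc e))))
           (cong₂ _++_ (sym (Listₚ.map-∘ {g = K ↑ʳ_} {f = _↑ˡ (K ℕ.+ suc e)} (allFin (K ℕ.+ K))))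
                       (sym (Listₚ.map-∘ {g = K ↑ʳ_} {f = (K ℕ.+ K) ↑ʳ_} (allFin (K ℕ.+ suc e))))))))

  module _ {p s : ℕ} (A : Alg n p s) (solves : SolvesConnOnIntervals A) where

    State : Set
    State = Vec Bool s

    phase : ∀ {k} → (Fin k → Fin n) → Stream n → Fin p → State → State
    phase f τ k st = foldl (λ st i → update A k i (τ i) st) st (map f (allFin _))

    phase-cong : ∀ {k} (f : Fin k → Fin n) {τ τ′ : Stream n} → (∀ j → τ (f j) ≡ τ′ (f j)) →
      ∀ t st → phase f τ t st ≡ phase f τ′ t st
    phase-cong {k} f {τ} {τ′} eq t st = go (allFin k) st
      where
      go : ∀ js st → foldl (λ st i → update A t i (τ i) st) st (map f js) ≡ foldl (λ st i → update A t i (τ′ i) st) st (map f js)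
      go []       st = refl
      go (j ∷ js) st rewrite eq j = go js _

    runPass-phases : ∀ τ t st → runPass A τ t st ≡ phase inC τ t (phase inB τ t (phase inA τ t st))
    runPass-phases τ t st = trans (cong (foldl f st) allFin-n)
      (trans (Listₚ.foldl-++ f st (map inA (allFin K)) _)
             (Listₚ.foldl-++ f _ (map inB (allFin (K ℕ.+ K))) _))
      where
      f : State → Fin n → State
      f = λ st i → update A t i (τ i) st

    -- Placeholders for the input on a player's own forehead. The items that the player processes
    -- are the same for every value of it; `y₀` stands in for both kinds of pointers.
    z₀ : Tables m
    z₀ = replicate m (replicate (r ℕ.* r) false)

    y₀ : Ptrs m
    y₀ = replicate m x₀

    steps : Fin p → List (Step (Ptrs m) (Ptrs m) (Tables m) State)
    steps t = stepA (λ ys zs → phase inA (σ y₀ ys zs) t)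
            ∷ stepB (λ xs zs → phase inB (σ xs y₀ zs) t)
            ∷ stepC (λ xs ys → phase inC (σ xs ys z₀) t) ∷ []

    exec-steps : ∀ xs ys zs t st → foldl (apply xs ys zs) st (steps t) ≡ runPass A (σ xs ys zs) t st
    exec-steps xs ys zs t st = sym (trans (runPass-phases (σ xs ys zs) t st)
      (trans (phase-cong inC (σ-inC xs ys zs z₀) t _)
             (cong (phase inC (σ xs ys z₀) t)
               (trans (phase-cong inB (σ-inB xs ys y₀ zs) t _)
                      (cong (phase inB (σ xs y₀ zs) t) (phase-cong inA (σ-inA xs y₀ ys zs) t st))))))

    exec-concatMap : ∀ xs ys zs ts st → exec (concatMap steps ts) st xs ys zs ≡ foldl (λ st t → runPass A (σ xs ys zs) t st) st ts
    exec-concatMap xs ys zs []       st = refl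
    exec-concatMap xs ys zs (t ∷ ts) st = trans (exec-concatMap xs ys zs ts _)
      (cong (λ st → foldl (λ st t → runPass A (σ xs ys zs) t st) st ts) (exec-steps xs ys zs t st))

    length-concatMap : ∀ ts → length (concatMap steps ts) ≡ 3 ℕ.* length ts
    length-concatMap []       = refl
    length-concatMap (t ∷ ts) = trans (cong (3 ℕ.+_) (length-concatMap ts)) (sym (ℕₚ.*-suc 3 (length ts)))

    run≡ok : ∀ xs ys zs → run A (σ xs ys zs) ≡ ok xs ys zs
    run≡ok xs ys zs with ok xs ys zs in eq
    -- The first pad is taken as the origin of the chain.
    ... | true  = Equivalence.from connected⇔ (G.connected xs ys zs (ok⇒bridged xs ys zs eq ∘ coords) (inC (K ↑ʳ zero))
                    (G.∋-vertex xs ys zs vertex-pad ℕₚ.≤-refl ℕₚ.≤-refl))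
      where connected⇔ = solves (G.graph xs ys zs) (G.isInterval xs ys zs)
    ... | false = let (i , s , t) , broken = ¬ok⇒broken xs ys zs eq in
                  Boolₚ.¬-not (λ e → G.disconnected xs ys zs (combine i (combine s t))
                    (subst (λ g → xbit xs g ∨ (ybit ys g ∨ zbit zs g) ≡ false) (sym (coords-combine i s t)) broken)
                    (Equivalence.to connected⇔ e))
      where connected⇔ = solves (G.graph xs ys zs) (G.isInterval xs ys zs)

    -- With 2^s memory states and 3p steps T is 2^(3ps), and the bound T⁴P⁵ turns into a power of
    -- two.
    pointers≤2^ : r ℕ.^ m ℕ.≤ 2 ℕ.^ (12 ℕ.* (p ℕ.* s) ℕ.+ 5 ℕ.* m)
    pointers≤2^ = ℕₚ.≤-trans
      (LowerBound.pointers≤ r m (vecs bools s) (∈-vecs bools ∈-bools) (Vecₚ.≡-dec Boolₚ._≟_) (output A)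
        (concatMap steps (allFin p)) (init A)
        (λ xs ys zs → trans (cong (output A) (exec-concatMap xs ys zs (allFin p) (init A))) (run≡ok xs ys zs)))
      (ℕₚ.≤-reflexive (begin
        (fourth T ℕ.* fourth (2 ℕ.^ m)) ℕ.* 2 ℕ.^ m
          ≡⟨ cong (λ t → (fourth t ℕ.* fourth (2 ℕ.^ m)) ℕ.* 2 ℕ.^ m) T≡ ⟩
        (fourth (2 ℕ.^ u) ℕ.* fourth (2 ℕ.^ m)) ℕ.* 2 ℕ.^ m
          ≡⟨ cong₂ (λ s t → (s ℕ.* t) ℕ.* 2 ℕ.^ m) (fourth-2^ u) (fourth-2^ m) ⟩
        (2 ℕ.^ (4 ℕ.* u) ℕ.* 2 ℕ.^ (4 ℕ.* m)) ℕ.* 2 ℕ.^ m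
          ≡⟨ cong (ℕ._* 2 ℕ.^ m) (sym (ℕₚ.^-distribˡ-+-* 2 (4 ℕ.* u) (4 ℕ.* m))) ⟩
        2 ℕ.^ (4 ℕ.* u ℕ.+ 4 ℕ.* m) ℕ.* 2 ℕ.^ m
          ≡⟨ sym (ℕₚ.^-distribˡ-+-* 2 (4 ℕ.* u ℕ.+ 4 ℕ.* m) m) ⟩
        2 ℕ.^ (4 ℕ.* u ℕ.+ 4 ℕ.* m ℕ.+ m)
          ≡⟨ cong (2 ℕ.^_) (exponent s p m) ⟩
        2 ℕ.^ (12 ℕ.* (p ℕ.* s) ℕ.+ 5 ℕ.* m) ∎))
      where
      open ≡-Reasoning
      T u : ℕ
      T = length (vecs bools s) ℕ.^ length (concatMap steps (allFin p))
      u = s ℕ.* (3 ℕ.* p)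
      T≡ : T ≡ 2 ℕ.^ u
      T≡ = trans (cong₂ ℕ._^_ (length-vecs bools s)
                   (trans (length-concatMap (allFin p)) (cong (3 ℕ.*_) {length (allFin p)} {p} (Listₚ.length-tabulate id))))
                 (ℕₚ.^-*-assoc 2 s (3 ℕ.* p))
      fourth-2^ : ∀ k → fourth (2 ℕ.^ k) ≡ 2 ℕ.^ (4 ℕ.* k)
      fourth-2^ k = trans (cong₂ ℕ._*_ double double) (trans (sym (ℕₚ.^-distribˡ-+-* 2 (k ℕ.+ k) (k ℕ.+ k)))
        (cong (2 ℕ.^_) (four k)))
        where
        double = sym (ℕₚ.^-distribˡ-+-* 2 k k)
        four : ∀ k → (k ℕ.+ k) ℕ.+ (k ℕ.+ k) ≡ 4 ℕ.* k
        four = ℕRing.solve-∀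
      exponent : ∀ s p m → 4 ℕ.* (s ℕ.* (3 ℕ.* p)) ℕ.+ 4 ℕ.* m ℕ.+ m ≡ 12 ℕ.* (p ℕ.* s) ℕ.+ 5 ℕ.* m
      exponent = ℕRing.solve-∀

-- Choice of the block size and the linear bound.

2^-cancel-≤ : ∀ {k l} → 2 ℕ.^ k ℕ.≤ 2 ℕ.^ l → k ℕ.≤ l
2^-cancel-≤ {k} {l} le = ℕₚ.≮⇒≥ λ l<k → ℕₚ.<⇒≱ (ℕₚ.^-monoʳ-< 2 (s≤s (s≤s z≤n)) l<k) le

-- r = 64 enters only propositionally, so that no large numeral is unfolded.
module BlockSize (r : ℕ) (r≡2^6 : r ≡ 2 ℕ.^ 6) .{{_ : NonZero r}} where

  -- The number of vertices per block: r² gadgets with four vertices each.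
  d : ℕ
  d = 4 ℕ.* (r ℕ.* r)

  instance
    d≢0 : NonZero d
    d≢0 = ℕₚ.m*n≢0 4 (r ℕ.* r) {{_}} {{ℕₚ.m*n≢0 r r}}

  -- Comparing exponents in 2^(6m) ≤ 2^(12ps + 5m). The exponent of r has to exceed 5, which
  -- explains the choice r = 2^6.
  blocks≤ : ∀ {n p s} m e → n ≡ suc e ℕ.+ m ℕ.* d → (A : Alg n p s) → SolvesConnOnIntervals A → m ℕ.≤ 12 ℕ.* (p ℕ.* s)
  blocks≤ {n} {p} {s} m e eq = go (trans eq (layout (r ℕ.* r) m e))
    where
    layout : ∀ q m e → suc e ℕ.+ m ℕ.* (4 ℕ.* q) ≡ m ℕ.* q ℕ.+ ((m ℕ.* q ℕ.+ m ℕ.* q) ℕ.+ (m ℕ.* q ℕ.+ suc e))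
    layout = ℕRing.solve-∀
    -- The default pointer is 0, available because r is nonzero.
    module Red = Reduction r (fromℕ< {0} (ℕₚ.n≢0⇒n>0 (ℕ.≢-nonZero⁻¹ r))) m e
    go : n ≡ Red.n → (A : Alg n p s) → SolvesConnOnIntervals A → m ℕ.≤ 12 ℕ.* (p ℕ.* s)
    go refl A solves = ℕₚ.+-cancelʳ-≤ (5 ℕ.* m) m _ (2^-cancel-≤ (subst (ℕ._≤ _)
      (trans (cong (ℕ._^ m) r≡2^6) (ℕₚ.^-*-assoc 2 6 m)) (Red.pointers≤2^ A solves)))

  -- Dividing the number of vertices minus one by d yields m blocks; the remainder plus one counts
  -- the pads, at most d of them. So the size is at most (m + 1)d, and m + 1 ≤ 12ps + ps.
  linear : ∀ (n p s : ℕ) → suc d ℕ.≤ n → 1 ℕ.≤ p → (A : Alg n p s) → SolvesConnOnIntervals A → n ℕ.≤ (13 ℕ.* d) ℕ.* (p ℕ.* s)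
  linear (suc n) p s (s≤s d≤n) _ A solves = begin
    suc n                                  ≡⟨ cong suc (DivMod.m≡m%n+[m/n]*n n d) ⟩
    suc (n DivMod.% d) ℕ.+ m ℕ.* d         ≤⟨ ℕₚ.+-monoˡ-≤ (m ℕ.* d) (DivMod.m%n<n n d) ⟩
    suc m ℕ.* d                            ≤⟨ ℕₚ.*-monoˡ-≤ d (ℕₚ.+-mono-≤ 1≤ps m≤) ⟩
    (13 ℕ.* (p ℕ.* s)) ℕ.* d               ≡⟨ swap (p ℕ.* s) d ⟩
    (13 ℕ.* d) ℕ.* (p ℕ.* s)               ∎
    where
    open ℕₚ.≤-Reasoning
    m : ℕ
    m = n DivMod./ d
    swap : ∀ t d → (13 ℕ.* t) ℕ.* d ≡ (13 ℕ.* d) ℕ.* t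
    swap = ℕRing.solve-∀
    m≤ : m ℕ.≤ 12 ℕ.* (p ℕ.* s)
    m≤ = blocks≤ m (n DivMod.% d) (cong suc (DivMod.m≡m%n+[m/n]*n n d)) A solves
    -- At least one whole block fits, and ps = 0 would force m = 0.
    1≤ps : 1 ℕ.≤ p ℕ.* s
    1≤ps = ℕₚ.n≢0⇒n>0 λ ps≡0 → ℕₚ.<⇒≱ (DivMod.m≥n⇒m/n>0 d≤n)
      (subst (λ t → m ℕ.≤ 12 ℕ.* t) ps≡0 m≤)

theorem37 : Σ ℕ λ C → Σ ℕ λ N → ∀ (n p s : ℕ) → N ≤ n → 1 ≤ p → (A : Alg n p s) → SolvesConnOnIntervals A → n ≤ C * (p * s)
-- The threshold is inferred to be d + 1: one block and one pad.
theorem37 = 13 * BlockSize.d 64 refl , _ , BlockSize.linear 64 refl
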